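{- Let $k \geq 2$ be an integer. For each $k$-admissible integer $n$ such that $n \geq 2k$, any partial $k$-star design of order $n$ with at most $u(n,k)$ stars has a completion, where \[u(n,k)= \begin{cases} 2 \lfloor \frac{n-2}{k} \rfloor-1 & \text{if $n \not \equiv 1\pmod{k}$},\\ \frac{2(n-1)}{k} - 2 & \text{if $n \equiv 1\pmod{k}$.} \end{cases} \] Furthermore, for each $k$-admissible integer $n > 1$, there is a partial $k$-star design of order $n$ with $u(n,k)+1$ stars that has no completion.
   Context: A $k$-star is a copy of the complete bipartite graph $K_{1,k}$. For a set $V$, $K_V$ denotes the complete graph on $V$. A partial $k$-star design of order $n$ is a pair $(V,\mathcal{A})$ where $V$ is a set of $n$ vertices and $\mathcal{A}$ is a set of edge-disjoint $k$-stars that are subgraphs of $K_V$ (i.e. a $k$-star decomposition of some subgraph of $K_V$); if every edge of $K_V$ lies in some star of $\mathcal{A}$ it is a $k$-star design. A completion of $(V,\mathcal{A})$ is a $k$-star design $(V,\mathcal{B})$ with $\mathcal{A}\subseteq\mathcal{B}$. A positive integer $n$ is $k$-admissible if $\binom{n}{2}\equiv 0 \pmod{k}$. -}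

module Defs where

open import Data.Bool.Base using (if_then_else_)
open import Data.Fin.Base using (Fin)
open import Data.Fin.Subset using (Subset; ∣_∣; _∈_; _∉_)
open import Data.Integer.Base as ℤ using (ℤ; +_; _/ℕ_)
open import Data.List.Base using (List; length)
open import Data.List.Relation.Binary.Subset.Propositional using (_⊆_)
open import Data.List.Relation.Unary.AllPairs using (AllPairs)
open import Data.List.Relation.Unary.Any using (Any)
open import Data.Nat.Base using (ℕ; NonZero; _>_; _%_)
open import Data.Nat.Combinatorics using (_C_)
open import Data.Nat.Divisibility using (_∣_)
open import Data.Nat.Properties using (_≟_)
open import Data.Product.Base using (_×_; ∃-syntax)
open import Data.Sum.Base using (_⊎_)
open import Relation.Binary.PropositionalEquality using (_≡_; _≢_)
open import Relation.Nullary using (¬_; does)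

-- A copy of K_{1,k} in the complete graph on Fin n.  For k ≥ 2 the subgraph
-- determines its centre, so stars with the same edges have equal centres and
-- leaves; the proof fields are irrelevant so that such stars are equal as
-- records (this matters for the inclusion 𝒜 ⊆ ℬ below).
record Star (n k : ℕ) : Set where
  constructor star
  field
    centre           : Fin n
    leaves           : Subset n
    .centre∉leaves   : centre ∉ leaves
    .numberOfLeaves  : ∣ leaves ∣ ≡ k

-- Edges are unordered: HasEdge S is symmetric in its two vertices.
HasEdge : ∀ {n k} → Star n k → Fin n → Fin n → Set
HasEdge S x y = (x ≡ centre × y ∈ leaves) ⊎ (y ≡ centre × x ∈ leaves)
  where open Star S

EdgeDisjoint : ∀ {n k} → Star n k → Star n k → Set
EdgeDisjoint S T = ∀ x y → ¬ (HasEdge S x y × HasEdge T x y)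

-- For k ≥ 1 a star is never edge-disjoint from itself, so AllPairs rules out
-- repetitions and the list represents a set with `length stars` elements.
record PartialDesign (n k : ℕ) : Set where
  constructor partialDesign
  field
    stars    : List (Star n k)
    disjoint : AllPairs EdgeDisjoint stars

open PartialDesign public

size : ∀ {n k} → PartialDesign n k → ℕ
size 𝒜 = length (stars 𝒜)

IsDesign : ∀ {n k} → PartialDesign n k → Set
IsDesign 𝒜 = ∀ x y → x ≢ y → Any (λ S → HasEdge S x y) (stars 𝒜)

HasCompletion : ∀ {n k} → PartialDesign n k → Set
HasCompletion {n} {k} 𝒜 =
  ∃[ ℬ ] (IsDesign {n} {k} ℬ × stars 𝒜 ⊆ stars ℬ)

Admissible : (k n : ℕ) → Set
Admissible k n = n > 0 × k ∣ (n C 2)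

-- Integer-valued because u n k = -1 when 2 ≤ n ≤ k.  _/ℕ_ rounds towards -∞;
-- in the case n ≡ 1 (mod k) the division is exact.
u : (n k : ℕ) .{{_ : NonZero k}} → ℤ
u n k =
  if does (n % k ≟ 1 % k)
  then ((+ 2 ℤ.* (+ n ℤ.- + 1)) /ℕ k) ℤ.- + 2
  else (+ 2 ℤ.* ((+ n ℤ.- + 2) /ℕ k)) ℤ.- + 1

-- A completion amounts to a tournament on the vertices that contains every arc
-- from the centre of a given star to one of its leaves and whose scores are all
-- divisible by k: the remaining arcs at each vertex can then be grouped into
-- k-stars arbitrarily.
--
-- The vertices are settled one at a time.  A centre with the most stars goes
-- first and receives every edge not in one of its own stars.  The bound u(n,k)
-- leaves each other centre at least k - 1 free edges to non-centres, enough to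
-- adjust its score modulo k.  It also leaves N ≥ 2k - 1 non-centres, among
-- which no arc is prescribed but each score is prescribed modulo k.  Starting
-- from the least residues and repeatedly adding k to the smallest target gives
-- target scores with the correct total that differ by at most k, and because
-- N ≥ 2k - 1 they satisfy Landau's condition.  The transitive tournament
-- ordered by the targets is then brought to them by moving units of score from
-- a vertex to one of no larger score, which reversing a path of one or two
-- arcs always achieves.
--
-- For the uncompletable designs, two vertices x and y are each the centre of as
-- many stars as possible avoiding the edge xy, so that fewer than k edges remain
-- at each.  If n ≡ 1 (mod k), exactly k edges would remain, and one more star
-- with x and y among its leaves removes one of them at each.
{-# OPTIONS --safe #-}
module Submission where

open import Defs
open import Data.Bool.Base using (Bool; true; false; if_then_else_; not; _∧_; _∨_; _xor_)
import Data.Bool.Properties as Bool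
open import Data.Empty using (⊥-elim; ⊥-elim-irr)
open import Data.Fin.Base using (Fin; zero; suc; toℕ)
open import Data.Fin.Properties using (_≟_; toℕ-injective; toℕ<n)
open import Data.Fin.Subset using (Subset; inside; outside; ∣_∣; ∁)
  renaming (_∈_ to _∈ˢ_; _∉_ to _∉ˢ_; _⊆_ to _⊆ˢ_; ⊥ to ∅)
open import Data.Fin.Subset.Properties
  using (_∈?_; drop-there; p⊆q⇒∣p∣≤∣q∣; x∉p⇒x∈∁p; ∣∁p∣≡n∸∣p∣; ∣⊥∣≡0)
open import Data.List.Base using (List; []; _∷_; _++_; map; length; filter; concat; allFin; tabulate)
open import Data.List.Membership.Propositional using (_∈_; _∉_; find; lose)
open import Data.List.Membership.Propositional.Properties
  using (∈-allFin; ∈-concat⁻′; ∈-filter⁺; ∈-filter⁻; ∈-length; ∈-tabulate⁺; ∈-tabulate⁻; ∈-++⁺ˡ; ∈-++⁺ʳ; ∈-∃++)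
open import Data.List.Properties using (length-++; length-tabulate; map-tabulate; partition-defn)
open import Data.List.Relation.Binary.Permutation.Propositional
  using (_↭_; ↭-trans; ↭-prep; ↭-reflexive; ↭⇒↭ₛ; ↭ₛ⇒↭)
import Data.List.Relation.Binary.Permutation.Propositional.Properties as Perm
import Data.List.Relation.Binary.Permutation.Setoid.Properties as PermSetoid
open import Data.List.Relation.Unary.All as All using (All; []; _∷_)
import Data.List.Relation.Unary.All.Properties as All
open import Data.List.Relation.Unary.AllPairs using (AllPairs; []; _∷_)
import Data.List.Relation.Unary.AllPairs.Properties as AllPairs
open import Data.List.Relation.Unary.Any as Any using (Any; here; there; any?)
import Data.List.Relation.Unary.Any.Properties as Any
open import Data.List.Relation.Unary.Unique.Propositional using (Unique)
import Data.List.Relation.Unary.Unique.Propositional.Properties as Unique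
open import Data.Nat.Base
open import Data.Nat.Combinatorics using (nCk+nC[k+1]≡[n+1]C[k+1]; nC1≡n) renaming (_C_ to _choose_)
open import Data.Nat.Divisibility
  using (_∣_; divides; _∣0; ∣-refl; m∣m*n; n∣m*n; ∣m∣n⇒∣m+n; ∣m+n∣m⇒∣n)
open import Data.Nat.DivMod
open import Data.Nat.ListAction using (sum)
import Data.Nat.ListAction.Properties as Sum
import Data.Nat.Properties as ℕ
open import Data.Nat.Properties hiding (_≟_)
open import Data.Nat.Tactic.RingSolver using (solve-∀)
open import Data.Product.Base using (_×_; _,_; proj₁; proj₂; Σ-syntax; ∃-syntax)
open import Data.Sum.Base using (_⊎_; inj₁; inj₂; [_,_]′)
open import Data.Unit.Base using (⊤)
open import Function.Base using (_∘_; id)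
open import Relation.Binary.Definitions using (Total; Transitive; tri<; tri≈; tri>)
open import Relation.Binary.PropositionalEquality
open import Relation.Nullary
open import Relation.Nullary.Decidable using (dec-true; dec-false; decidable-stable)
open import Relation.Unary using (Decidable)

-- Sums over lists.

∑ : {A : Set} → List A → (A → ℕ) → ℕ
∑ xs f = sum (map f xs)

𝟙 : Bool → ℕ
𝟙 b = if b then 1 else 0

module _ {A : Set} where

  private variable
    xs ys : List A
    f g : A → ℕ
    a b : A

  ∑-++ : ∀ xs ys (f : A → ℕ) → ∑ (xs ++ ys) f ≡ ∑ xs f + ∑ ys f
  ∑-++ []       ys f = refl
  ∑-++ (x ∷ xs) ys f = trans (cong (f x +_) (∑-++ xs ys f)) (sym (+-assoc (f x) _ _))

  ∑-↭ : ∀ (f : A → ℕ) → xs ↭ ys → ∑ xs f ≡ ∑ ys f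
  ∑-↭ f p = Sum.sum-↭ (Perm.map⁺ f p)

  Unique-resp-↭ : xs ↭ ys → Unique xs → Unique ys
  Unique-resp-↭ p = PermSetoid.Unique-resp-↭ (setoid A) (↭⇒↭ₛ p)

  filter-↭ : ∀ {P : A → Set} (P? : Decidable P) xs →
             xs ↭ filter P? xs ++ filter (¬? ∘ P?) xs
  filter-↭ P? xs = subst (λ p → xs ↭ proj₁ p ++ proj₂ p)
    (partition-defn P? xs) (↭ₛ⇒↭ (PermSetoid.partition-↭ (setoid A) P? xs))

  ∑-cong : (∀ {x} → x ∈ xs → f x ≡ g x) → ∑ xs f ≡ ∑ xs g
  ∑-cong {xs = []}     eq = refl
  ∑-cong {xs = x ∷ xs} eq = cong₂ _+_ (eq (here refl)) (∑-cong {xs = xs} (eq ∘ there))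

  ∑-mono : (∀ {x} → x ∈ xs → f x ≤ g x) → ∑ xs f ≤ ∑ xs g
  ∑-mono {xs = []}     le = z≤n
  ∑-mono {xs = x ∷ xs} le = +-mono-≤ (le (here refl)) (∑-mono {xs = xs} (le ∘ there))

  ∑-mono-strict : (∀ {x} → x ∈ xs → f x ≤ g x) → a ∈ xs → f a < g a → ∑ xs f < ∑ xs g
  ∑-mono-strict {xs = x ∷ xs} le (here refl) lt =
    +-mono-<-≤ lt (∑-mono {xs = xs} (le ∘ there))
  ∑-mono-strict {xs = x ∷ xs} le (there a∈) lt =
    +-mono-≤-< (le (here refl)) (∑-mono-strict (le ∘ there) a∈ lt)

  ∑-mono-tight : (∀ {x} → x ∈ xs → f x ≤ g x) → ∑ xs f ≡ ∑ xs g → a ∈ xs → f a ≡ g a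
  ∑-mono-tight {f = f} {g} {a = a} le eq a∈ with f a <? g a
  ... | yes lt = contradiction eq (<⇒≢ (∑-mono-strict le a∈ lt))
  ... | no ≮   = ≤-antisym (le a∈) (≮⇒≥ ≮)

  ∑-+ : ∀ xs (f g : A → ℕ) → ∑ xs (λ x → f x + g x) ≡ ∑ xs f + ∑ xs g
  ∑-+ []       f g = refl
  ∑-+ (x ∷ xs) f g = trans (cong (f x + g x +_) (∑-+ xs f g)) (lemma (f x) (g x) _ _)
    where
    lemma : ∀ a b c d → a + b + (c + d) ≡ a + c + (b + d)
    lemma = solve-∀

  ∑-const : ∀ (xs : List A) c → ∑ xs (λ _ → c) ≡ length xs * c
  ∑-const []       c = refl
  ∑-const (x ∷ xs) c = cong (c +_) (∑-const xs c)

  ∑-* : ∀ c xs (f : A → ℕ) → ∑ xs (λ x → c * f x) ≡ c * ∑ xs f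
  ∑-* c []       f = sym (*-zeroʳ c)
  ∑-* c (x ∷ xs) f = trans (cong (c * f x +_) (∑-* c xs f)) (sym (*-distribˡ-+ c (f x) _))

  -- Both changed values are added, so that truncated subtraction is avoided whichever of `f b` and
  -- `g b` is larger.
  ∑-update : Unique xs → b ∈ xs → (∀ {x} → x ∈ xs → x ≢ b → f x ≡ g x) →
             ∑ xs f + g b ≡ ∑ xs g + f b
  ∑-update {f = f} {g} (x∉ ∷ _) (here {xs = xs} refl) eq = begin
    f _ + ∑ xs f + g _   ≡⟨ cong (λ s → f _ + s + g _) (∑-cong {xs = xs} λ x∈ → eq (there x∈) (≢-sym (All.lookup x∉ x∈))) ⟩
    f _ + ∑ xs g + g _   ≡⟨ lemma (f _) _ (g _) ⟩
    g _ + ∑ xs g + f _   ∎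
    where
    open ≡-Reasoning
    lemma : ∀ a b c → a + b + c ≡ c + b + a
    lemma = solve-∀
  ∑-update {b = b} {f} {g} (x∉ ∷ u) (there {x = x} {xs = xs} b∈) eq = begin
    f x + ∑ xs f + g b   ≡⟨ +-assoc (f x) _ _ ⟩
    f x + (∑ xs f + g b) ≡⟨ cong₂ _+_ (eq (here refl) (All.lookup x∉ b∈)) (∑-update u b∈ (eq ∘ there)) ⟩
    g x + (∑ xs g + f b) ≡⟨ +-assoc (g x) _ _ ⟨
    g x + ∑ xs g + f b   ∎
    where open ≡-Reasoning

-- Tournaments and their scores.

record Tournament (n : ℕ) : Set where
  field
    beats  : Fin n → Fin n → Bool
    irrefl : ∀ v → beats v v ≡ false
    anti   : ∀ {v w} → v ≢ w → beats w v ≡ not (beats v w)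

  score : List (Fin n) → Fin n → ℕ
  score ws v = ∑ ws (𝟙 ∘ beats v)

open Tournament

private variable
  n k : ℕ
  ws : List (Fin n)

𝟙-not : ∀ b → 𝟙 b + 𝟙 (not b) ≡ 1
𝟙-not true  = refl
𝟙-not false = refl

-- The binomial coefficient l(l - 1)/2, in a form suited to removing one vertex at a time.
triangle : ℕ → ℕ
triangle zero    = 0
triangle (suc l) = l + triangle l

2triangle : ∀ l → 2 * triangle l + l ≡ l * l
2triangle zero    = refl
2triangle (suc l) = begin
  2 * (l + triangle l) + suc l        ≡⟨ regroup l (triangle l) ⟩
  suc (l + l) + (2 * triangle l + l)  ≡⟨ cong (suc (l + l) +_) (2triangle l) ⟩
  suc (l + l) + l * l                 ≡⟨ square l ⟩
  suc l * suc l                       ∎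
  where
  open ≡-Reasoning
  regroup : ∀ l S → 2 * (l + S) + suc l ≡ suc (l + l) + (2 * S + l)
  regroup = solve-∀
  square : ∀ l → suc (l + l) + l * l ≡ suc l * suc l
  square = solve-∀

-- Every pair of vertices contributes one arc: the row and the column of `x` pair up by `anti` to
-- one per remaining vertex.
handshake : (T : Tournament n) → Unique ws → ∑ ws (score T ws) ≡ triangle (length ws)
handshake T [] = refl
handshake {ws = x ∷ ws} T (x∉ ∷ u) = begin
  score T (x ∷ ws) x + ∑ ws (score T (x ∷ ws))
    ≡⟨ cong₂ _+_ (cong (λ b → 𝟙 b + score T ws x) (irrefl T x)) (∑-+ ws (λ v → 𝟙 (beats T v x)) (score T ws)) ⟩
  ∑ ws (𝟙 ∘ beats T x) + (∑ ws (λ v → 𝟙 (beats T v x)) + S)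
    ≡⟨ +-assoc (∑ ws (𝟙 ∘ beats T x)) _ _ ⟨
  ∑ ws (𝟙 ∘ beats T x) + ∑ ws (λ v → 𝟙 (beats T v x)) + S
    ≡⟨ cong (_+ S) (∑-+ ws (𝟙 ∘ beats T x) _) ⟨
  ∑ ws (λ v → 𝟙 (beats T x v) + 𝟙 (beats T v x)) + S
    ≡⟨ cong (_+ S) (∑-cong {xs = ws} λ {v} v∈ →
         trans (cong (λ b → 𝟙 (beats T x v) + 𝟙 b) (anti T (All.lookup x∉ v∈))) (𝟙-not (beats T x v))) ⟩
  ∑ ws (λ _ → 1) + S
    ≡⟨ cong₂ _+_ (trans (∑-const ws 1) (*-identityʳ l)) (handshake T u) ⟩
  l + triangle l ∎
  where
  open ≡-Reasoning
  l = length ws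
  S = ∑ ws (score T ws)

-- Moving a unit of score by reversing arcs.

module _ (a b : Fin n) where

  isPair : Fin n → Fin n → Bool
  isPair v w = (does (v ≟ a) ∧ does (w ≟ b)) ∨ (does (v ≟ b) ∧ does (w ≟ a))

  isPair-sym : ∀ v w → isPair w v ≡ isPair v w
  isPair-sym v w = trans (Bool.∨-comm (does (w ≟ a) ∧ does (v ≟ b)) _)
    (cong₂ _∨_ (Bool.∧-comm (does (w ≟ b)) _) (Bool.∧-comm (does (w ≟ a)) _))

  isPair-diag : a ≢ b → ∀ v → isPair v v ≡ false
  isPair-diag a≢b v with v ≟ a | v ≟ b
  ... | yes refl | yes refl = contradiction refl a≢b
  ... | yes _    | no _     = refl
  ... | no _     | yes _    = refl
  ... | no _     | no _     = refl

  isPair-self : isPair a b ≡ true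
  isPair-self rewrite dec-true (a ≟ a) refl | dec-true (b ≟ b) refl = refl

  isPair-false : ∀ {v w} → ¬ (v ≡ a × w ≡ b) → ¬ (v ≡ b × w ≡ a) → isPair v w ≡ false
  isPair-false {v} {w} ≢₁ ≢₂ with v ≟ a | w ≟ b | v ≟ b | w ≟ a
  ... | yes p | yes q | _     | _     = contradiction (p , q) ≢₁
  ... | _     | _     | yes p | yes q = contradiction (p , q) ≢₂
  ... | yes _ | no _  | yes _ | no _  = refl
  ... | yes _ | no _  | no _  | _     = refl
  ... | no _  | _     | yes _ | no _  = refl
  ... | no _  | _     | no _  | _     = refl

-- `xor` with the symmetric indicator of the pair flips both of its entries at once, so `anti`
-- survives whichever way the arc points.
reverseArc : (T : Tournament n) (a b : Fin n) → a ≢ b → Tournament n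
reverseArc T a b a≢b = record
  { beats  = λ v w → beats T v w xor isPair a b v w
  ; irrefl = λ v → trans (cong₂ _xor_ (irrefl T v) (isPair-diag a b a≢b v)) refl
  ; anti   = λ {v} {w} v≢w → trans (cong₂ _xor_ (anti T v≢w) (isPair-sym a b v w))
                                   (sym (Bool.not-distribˡ-xor (beats T v w) _))
  }

record Transfer (ws : List (Fin n)) (T T′ : Tournament n) (x y : Fin n) : Set where
  field
    loss : suc (score T′ ws x) ≡ score T ws x
    gain : score T′ ws y ≡ suc (score T ws y)
    same : ∀ {v} → v ≢ x → v ≢ y → score T′ ws v ≡ score T ws v

open Transfer

module _ {T : Tournament n} {a b : Fin n} (a≢b : a ≢ b) where

  private T′ = reverseArc T a b a≢b

  reverseArc-elsewhere : ∀ {v w} → ¬ (v ≡ a × w ≡ b) → ¬ (v ≡ b × w ≡ a) →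
                         beats T′ v w ≡ beats T v w
  reverseArc-elsewhere ≢₁ ≢₂ =
    trans (cong (beats T _ _ xor_) (isPair-false a b ≢₁ ≢₂)) (Bool.xor-identityʳ _)

  reverseArc-transfer : Unique ws → a ∈ ws → b ∈ ws → beats T a b ≡ true →
                        Transfer ws T T′ a b
  reverseArc-transfer {ws} u a∈ b∈ ab = record
    { loss = begin
        suc (score T′ ws a)                ≡⟨ +-comm 1 _ ⟩
        score T′ ws a + 1                  ≡⟨ cong (λ c → score T′ ws a + 𝟙 c) ab ⟨
        score T′ ws a + 𝟙 (beats T a b)    ≡⟨ ∑-update u b∈ (λ _ w≢b → cong 𝟙 (reverseArc-elsewhere (w≢b ∘ proj₂) (a≢b ∘ proj₁))) ⟩
        score T ws a + 𝟙 (beats T′ a b)    ≡⟨ cong (λ c → score T ws a + 𝟙 c) ab′ ⟩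
        score T ws a + 0                   ≡⟨ +-identityʳ _ ⟩
        score T ws a                       ∎
    ; gain = begin
        score T′ ws b                      ≡⟨ +-identityʳ _ ⟨
        score T′ ws b + 0                  ≡⟨ cong (λ c → score T′ ws b + 𝟙 c) ba ⟨
        score T′ ws b + 𝟙 (beats T b a)    ≡⟨ ∑-update u a∈ (λ _ w≢a → cong 𝟙 (reverseArc-elsewhere (a≢b ∘ sym ∘ proj₁) (w≢a ∘ proj₂))) ⟩
        score T ws b + 𝟙 (beats T′ b a)    ≡⟨ cong (λ c → score T ws b + 𝟙 c) ba′ ⟩
        score T ws b + 1                   ≡⟨ +-comm _ 1 ⟩
        suc (score T ws b)                 ∎
    ; same = λ v≢a v≢b → ∑-cong {xs = ws} λ _ → cong 𝟙 (reverseArc-elsewhere (v≢a ∘ proj₁) (v≢b ∘ proj₁))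
    }
    where
    open ≡-Reasoning
    ab′ : beats T′ a b ≡ false
    ab′ = cong₂ _xor_ ab (isPair-self a b)
    ba : beats T b a ≡ false
    ba = trans (anti T a≢b) (cong not ab)
    ba′ : beats T′ b a ≡ true
    ba′ = trans (anti T′ a≢b) (cong not ab′)

-- The vertex `z` receives a unit and passes it on, so its own score returns to what it was.
Transfer-trans : ∀ {T T′ T″ : Tournament n} {x y z} → x ≢ y → x ≢ z → y ≢ z →
                 Transfer ws T T′ x z → Transfer ws T′ T″ z y → Transfer ws T T″ x y
Transfer-trans {z = z} x≢y x≢z y≢z p q = record
  { loss = trans (cong suc (same q x≢z x≢y)) (loss p)
  ; gain = trans (gain q) (cong suc (same p (≢-sym x≢y) y≢z))
  ; same = λ {v} v≢x v≢y → sameAs (v ≟ z) v≢x v≢y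
  }
  where
  sameAs : ∀ {v} → Dec (v ≡ z) → v ≢ _ → v ≢ _ → _
  sameAs (yes refl) _   _   = suc-injective (trans (loss q) (gain p))
  sameAs (no v≢z)   v≢x v≢y = trans (same q v≢z v≢y) (same p v≢x v≢z)

-- If `x` beats `y`, that arc is reversed. Otherwise a path from `x` through some `z` to `y` is
-- reversed. Without such a path `y` would beat everything that `x` beats and also `x` itself, so
-- its score would be the larger one.
transfer : (T : Tournament n) → Unique ws → ∀ {x y} → x ∈ ws → y ∈ ws → x ≢ y →
           score T ws y ≤ score T ws x → ∃[ T′ ] Transfer ws T T′ x y
transfer {ws = ws} T u {x} {y} x∈ y∈ x≢y y≤x with beats T x y in xy
... | true  = reverseArc T x y x≢y , reverseArc-transfer x≢y u x∈ y∈ xy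
... | false with any? (λ z → (beats T x z Bool.≟ true) ×-dec (beats T y z Bool.≟ false)) ws
...   | no none = contradiction (∑-mono-strict {xs = ws} below x∈ strict) (≤⇒≯ y≤x)
  where
  yx : beats T y x ≡ true
  yx = trans (anti T x≢y) (cong not xy)
  below : ∀ {z} → z ∈ ws → 𝟙 (beats T x z) ≤ 𝟙 (beats T y z)
  below {z} z∈ with beats T y z in yz | beats T x z in xz
  ... | true  | true  = ≤-refl
  ... | _     | false = z≤n
  ... | false | true  = contradiction (lose z∈ (xz , yz)) none
  strict : 𝟙 (beats T x x) < 𝟙 (beats T y x)
  strict rewrite irrefl T x | yx = ≤-refl
...   | yes some with find some
...     | z , z∈ , xz , yz =
  _ , Transfer-trans x≢y x≢z y≢z
        (reverseArc-transfer x≢z u x∈ z∈ xz)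
        (reverseArc-transfer (≢-sym y≢z) u z∈ y∈ zy)
  where
  x≢z : x ≢ z
  x≢z refl with () ← trans (sym (irrefl T x)) xz
  -- The test `beats T y z ≡ false` is also met by `y` itself, which is ruled out because `x` does
  -- not beat `y`.
  y≢z : y ≢ z
  y≢z refl with () ← trans (sym xy) xz
  zy : beats (reverseArc T x z x≢z) z y ≡ true
  zy = trans (reverseArc-elsewhere {T = T} x≢z (≢-sym x≢z ∘ proj₁) (≢-sym x≢y ∘ proj₂))
             (trans (anti T y≢z) (cong not yz))

-- The order is a parameter because `lift` needs a smallest target, which is a maximum for the
-- reversed order.
maximum : {A : Set} {P : A → Set} {_≼_ : A → A → Set} → Total _≼_ → Transitive _≼_ → Decidable P →
          ∀ {xs} → Any P xs → ∃[ m ] (m ∈ xs × P m × (∀ {x} → x ∈ xs → P x → x ≼ m))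
maximum {_≼_ = _≼_} total ≼-trans P? {x ∷ xs} p with any? P? xs
... | no none with p
...   | here px = x , here refl , px , λ where
          (here refl) _  → [ id , id ]′ (total x x)
          (there y∈)  py → contradiction (lose y∈ py) none
...   | there q = contradiction q none
maximum {_≼_ = _≼_} total ≼-trans P? {x ∷ xs} p | yes q with maximum total ≼-trans P? q
... | m , m∈ , pm , bound with P? x
...   | no ¬px = m , there m∈ , pm , λ where
          (here refl) py → contradiction py ¬px
          (there y∈)  py → bound y∈ py
...   | yes px with total x m
...     | inj₁ x≼m = m , there m∈ , pm , λ where
            (here refl) _  → x≼m
            (there y∈)  py → bound y∈ py
...     | inj₂ m≼x = x , here refl , px , λ where
            (here refl) _  → [ id , id ]′ (total x x)
            (there y∈)  py → ≼-trans (bound y∈ py) m≼x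

∑-indicator : ∀ {xs : List (Fin n)} {b} → Unique xs → b ∈ xs → ∑ xs (λ x → 𝟙 (does (x ≟ b))) ≡ 1
∑-indicator {xs = xs} {b} u b∈ = begin
  ∑ xs δ                      ≡⟨ +-identityʳ _ ⟨
  ∑ xs δ + 0                  ≡⟨ ∑-update u b∈ (λ {x} _ x≢b → cong 𝟙 (dec-false (x ≟ b) x≢b)) ⟩
  ∑ xs (λ _ → 0) + δ b        ≡⟨ cong₂ _+_ (trans (∑-const xs 0) (*-zeroʳ (length xs))) (cong 𝟙 (dec-true (b ≟ b) refl)) ⟩
  1                           ∎
  where
  open ≡-Reasoning
  δ : Fin _ → ℕ
  δ x = 𝟙 (does (x ≟ b))

-- At each vertex the new score plus the indicator of `x` equals the old score plus the indicator of
-- `y`, and both indicators sum to 1.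
∑-transfer : ∀ {T T′ : Tournament n} {xs x y} → x ≢ y → Transfer ws T T′ x y →
             Unique xs → x ∈ xs → y ∈ xs → ∑ xs (score T′ ws) ≡ ∑ xs (score T ws)
∑-transfer {ws = ws} {T} {T′} {xs} {x} {y} x≢y t u x∈ y∈ = +-cancelʳ-≡ 1 _ _ (begin
  ∑ xs (score T′ ws) + 1               ≡⟨ cong (∑ xs (score T′ ws) +_) (∑-indicator u x∈) ⟨
  ∑ xs (score T′ ws) + ∑ xs (δ x)      ≡⟨ ∑-+ xs _ _ ⟨
  ∑ xs (λ v → score T′ ws v + δ x v)   ≡⟨ ∑-cong {xs = xs} (λ {v} _ → pointwise v (v ≟ x) (v ≟ y)) ⟩
  ∑ xs (λ v → score T ws v + δ y v)    ≡⟨ ∑-+ xs _ _ ⟩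
  ∑ xs (score T ws) + ∑ xs (δ y)       ≡⟨ cong (∑ xs (score T ws) +_) (∑-indicator u y∈) ⟩
  ∑ xs (score T ws) + 1                ∎)
  where
  open ≡-Reasoning
  δ : Fin _ → Fin _ → ℕ
  δ b v = 𝟙 (does (v ≟ b))
  pointwise : ∀ v (p : Dec (v ≡ x)) (q : Dec (v ≡ y)) →
              score T′ ws v + 𝟙 (does p) ≡ score T ws v + 𝟙 (does q)
  pointwise v (yes refl) (yes refl) = contradiction refl x≢y
  pointwise v (yes refl) (no _)     = trans (+-comm _ 1) (trans (loss t) (sym (+-identityʳ _)))
  pointwise v (no _)     (yes refl) = trans (+-identityʳ _) (trans (gain t) (+-comm 1 _))
  pointwise v (no v≢x)   (no v≢y)   = cong (_+ 0) (same t v≢x v≢y)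

-- Reaching target scores by repeated transfers.

module RobinHood {n} (ws : List (Fin n)) (u : Unique ws) (g key : Fin n → ℕ)
  (key-injective : ∀ {v w} → key v ≡ key w → v ≡ w)
  (key-mono : ∀ {v w} → key v < key w → g v ≤ g w)
  where

  above : ℕ → List (Fin n)
  above κ = filter (λ v → κ ≤? key v) ws

  -- A majorization condition on the top segments of the order by `key`. For the transitive
  -- tournament of that order it is Landau's condition on the targets.
  Dominates : Tournament n → Set
  Dominates T = ∀ κ → ∑ (above κ) g ≤ ∑ (above κ) (score T ws)

  -- Induction on a bound `d` for the total deficiency. The deficient vertex `j` with the largest
  -- key receives a unit from a vertex `i` above it that exceeds its target.
  robinHood : ∀ d (T : Tournament n) → Dominates T → ∑ ws (λ v → g v ∸ score T ws v) ≤ d →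
              ∃[ T′ ] (∀ {v} → v ∈ ws → g v ≤ score T′ ws v)
  robinHood d T dom le with any? (λ v → score T ws v <? g v) ws
  ... | no none = T , λ v∈ → ≮⇒≥ (none ∘ lose v∈)
  ... | yes deficient
    with j , j∈ , j-deficient , j-max ←
      maximum {_≼_ = λ v w → key v ≤ key w} (λ v w → ≤-total (key v) (key w)) ≤-trans
        (λ v → score T ws v <? g v) deficient
    with any? (λ v → (key j <? key v) ×-dec (g v <? score T ws v)) ws
  -- Without an excess above `j`, no score in `above (key j)` exceeds its target and that of `j`
  -- falls short, against dominance at this threshold.
  ...   | no none = contradiction (dom (key j)) (<⇒≱ (∑-mono-strict noExcess j∈above j-deficient))
    where
    j∈above : j ∈ above (key j)
    j∈above = ∈-filter⁺ _ j∈ ≤-refl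
    noExcess : ∀ {v} → v ∈ above (key j) → score T ws v ≤ g v
    noExcess v∈above with v∈ , j≤v ← ∈-filter⁻ (λ v → key j ≤? key v) {xs = ws} v∈above
      with m≤n⇒m<n∨m≡n j≤v
    ... | inj₁ j<v = ≮⇒≥ λ excess → none (lose v∈ (j<v , excess))
    ... | inj₂ j≡v with refl ← key-injective j≡v = <⇒≤ j-deficient
  ...   | yes excess with i , i∈ , j<i , i-excess ← find excess
    -- The score of `j` is below g j ≤ g i, and that of `i` is above g i, so the transfer is
    -- allowed.
    with T′ , t ← transfer T u i∈ j∈ (λ i≡j → <⇒≢ j<i (sym (cong key i≡j)))
                    (<⇒≤ (<-≤-trans j-deficient (≤-trans (key-mono j<i) (<⇒≤ i-excess))))
    = continue d (<-≤-trans smaller le)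
    where
    i≢j : i ≢ j
    i≢j i≡j = <⇒≢ j<i (sym (cong key i≡j))

    i-stays : g i ≤ score T′ ws i
    i-stays = s≤s⁻¹ (subst (suc (g i) ≤_) (sym (loss t)) i-excess)

    dom′ : Dominates T′
    dom′ κ with κ ≤? key j | κ ≤? key i
    ... | yes κ≤j | _ = subst (∑ (above κ) g ≤_)
      (sym (∑-transfer i≢j t (Unique.filter⁺ _ u) (∈-filter⁺ _ i∈ (≤-trans κ≤j (<⇒≤ j<i))) (∈-filter⁺ _ j∈ κ≤j)))
      (dom κ)
    ... | no κ≰j | no κ≰i = ≤-trans (dom κ) (≤-reflexive (∑-cong unchanged))
      where
      unchanged : ∀ {v} → v ∈ above κ → score T ws v ≡ score T′ ws v
      unchanged v∈above with v∈ , κ≤v ← ∈-filter⁻ (λ v → κ ≤? key v) {xs = ws} v∈above =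
        sym (same t (λ { refl → κ≰i κ≤v }) (λ { refl → κ≰j κ≤v }))
    -- Only here does the sum of scores drop. All keys in the segment exceed that of `j`, so by the
    -- choice of `j` no vertex in it was deficient, and `i` had a unit to spare.
    ... | no κ≰j | yes κ≤i = ∑-mono kept
      where
      kept : ∀ {v} → v ∈ above κ → g v ≤ score T′ ws v
      kept {v} v∈above with v∈ , κ≤v ← ∈-filter⁻ (λ v → κ ≤? key v) {xs = ws} v∈above
        with v ≟ i
      ... | yes refl = i-stays
      ... | no v≢i   = subst (g v ≤_) (sym (same t v≢i λ { refl → κ≰j κ≤v }))
                         (≮⇒≥ λ v-deficient → κ≰j (≤-trans κ≤v (j-max v∈ v-deficient)))

    smaller : ∑ ws (λ v → g v ∸ score T′ ws v) < ∑ ws (λ v → g v ∸ score T ws v)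
    smaller = ∑-mono-strict {xs = ws} shrinks j∈
      (subst (λ s → g j ∸ s < g j ∸ score T ws j) (sym (gain t)) (∸-monoʳ-< ≤-refl j-deficient))
      where
      shrinks : ∀ {v} → v ∈ ws → g v ∸ score T′ ws v ≤ g v ∸ score T ws v
      shrinks {v} _ with v ≟ i | v ≟ j
      ... | yes refl | _        = subst (_≤ g i ∸ score T ws i) (sym (m≤n⇒m∸n≡0 i-stays)) z≤n
      ... | no _     | yes refl = ∸-monoʳ-≤ (g j) (subst (score T ws j ≤_) (sym (gain t)) (n≤1+n _))
      ... | no v≢i   | no v≢j   = ≤-reflexive (cong (g v ∸_) (same t v≢i v≢j))

    continue : ∀ d → ∑ ws (λ v → g v ∸ score T′ ws v) < d → _
    continue (suc d) lt = robinHood d T′ dom′ (s≤s⁻¹ lt)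

-- Landau's condition for targets in a window.

transitiveTournament : ∀ {n} (key : Fin n → ℕ) → (∀ {v w} → key v ≡ key w → v ≡ w) → Tournament n
transitiveTournament key injective = record
  { beats  = λ v w → does (key w <? key v)
  ; irrefl = λ v → dec-false (key v <? key v) (<-irrefl refl)
  ; anti   = anti′
  }
  where
  anti′ : ∀ {v w} → v ≢ w → does (key v <? key w) ≡ not (does (key w <? key v))
  anti′ {v} {w} v≢w with <-cmp (key v) (key w)
  ... | tri< lt _ ≯ = trans (dec-true (key v <? key w) lt) (cong not (sym (dec-false (key w <? key v) ≯)))
  ... | tri≈ _ eq _ = contradiction (injective eq) v≢w
  ... | tri> ≮ _ gt = trans (dec-false (key v <? key w) ≮) (cong not (sym (dec-true (key w <? key v) gt)))

-- The mean score (N - 1)/2 need not be an integer, so comparisons with it are made between 2f + 1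
-- and N.
∑-2f+1 : ∀ {A : Set} (xs : List A) f → ∑ xs (λ v → 2 * f v + 1) ≡ 2 * ∑ xs f + length xs
∑-2f+1 xs f = trans (∑-+ xs (λ v → 2 * f v) (λ _ → 1))
  (cong₂ _+_ (∑-* 2 xs f) (trans (∑-const xs 1) (*-identityʳ _)))

module _ {n} (ws : List (Fin n)) (u : Unique ws) (k : ℕ) (2k≤1+N : 2 * k ≤ suc (length ws))
  (g : Fin n → ℕ) (total : ∑ ws g ≡ triangle (length ws))
  (window : ∀ {v w} → v ∈ ws → w ∈ ws → g v ≤ g w + k)
  where

  private
    -- Lexicographic encoding: since `toℕ v < n`, the target decides first and the index breaks
    -- ties.
    key : Fin n → ℕ
    key v = g v * n + toℕ v

    key-reflects : ∀ {v w} → g v < g w → key v < key w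
    key-reflects {v} {w} lt = begin-strict
      g v * n + toℕ v  <⟨ +-monoʳ-< (g v * n) (toℕ<n v) ⟩
      g v * n + n      ≡⟨ +-comm (g v * n) n ⟩
      suc (g v) * n    ≤⟨ *-monoˡ-≤ n lt ⟩
      g w * n          ≤⟨ m≤m+n (g w * n) (toℕ w) ⟩
      key w            ∎
      where open ≤-Reasoning

    key-mono : ∀ {v w} → key v < key w → g v ≤ g w
    key-mono lt = ≮⇒≥ λ gt → <-asym lt (key-reflects gt)

    key-injective : ∀ {v w} → key v ≡ key w → v ≡ w
    key-injective {v} {w} eq with <-cmp (g v) (g w)
    ... | tri< lt _ _ = contradiction eq (<⇒≢ (key-reflects lt))
    ... | tri> _ _ gt = contradiction (sym eq) (<⇒≢ (key-reflects gt))
    ... | tri≈ _ gv≡gw _ = toℕ-injective (+-cancelˡ-≡ (g v * n) _ _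
                             (trans eq (cong (λ x → x * n + toℕ w) (sym gv≡gw))))

    T₀ : Tournament n
    T₀ = transitiveTournament key key-injective

    open RobinHood ws u g key key-injective key-mono

    -- In `T₀` every vertex of `S` beats all of `S̄`, so the scores on `S` sum to
    -- `triangle s + s * t`. The comparison with the targets is doubled to clear the halves.
    dominates : Dominates T₀
    dominates κ = *-cancelˡ-≤ 2 (+-cancelʳ-≤ s _ _ (begin
      2 * ∑ S g + s                      ≤⟨ upper ⟩
      s * (s + 2 * t)                    ≡⟨ expand s t ⟩
      s * s + 2 * (s * t)                ≡⟨ cong (_+ 2 * (s * t)) (2triangle s) ⟨
      2 * triangle s + s + 2 * (s * t)   ≡⟨ regroup (triangle s) s (s * t) ⟩
      2 * (triangle s + s * t) + s       ≡⟨ cong (λ x → 2 * x + s) score-above ⟨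
      2 * ∑ S (score T₀ ws) + s          ∎))
      where
      open ≤-Reasoning
      S = above κ
      S̄ = filter (λ v → ¬? (κ ≤? key v)) ws
      s = length S
      t = length S̄
      expand : ∀ s t → s * (s + 2 * t) ≡ s * s + 2 * (s * t)
      expand = solve-∀
      regroup : ∀ x s y → 2 * x + s + 2 * y ≡ 2 * (x + y) + s
      regroup = solve-∀

      ws↭ = filter-↭ (λ v → κ ≤? key v) ws

      in-S : ∀ {v} → v ∈ S → v ∈ ws × κ ≤ key v
      in-S = ∈-filter⁻ (λ v → κ ≤? key v) {xs = ws}

      in-S̄ : ∀ {v} → v ∈ S̄ → v ∈ ws × ¬ κ ≤ key v
      in-S̄ = ∈-filter⁻ (λ v → ¬? (κ ≤? key v)) {xs = ws}

      s+t≡N : s + t ≡ length ws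
      s+t≡N = trans (sym (length-++ S)) (sym (Perm.↭-length ws↭))

      split : ∀ f → ∑ ws f ≡ ∑ S f + ∑ S̄ f
      split f = trans (∑-↭ f ws↭) (∑-++ S S̄ f)

      score-S : ∀ {v} → v ∈ S → score T₀ ws v ≡ score T₀ S v + t
      score-S {v} v∈ = trans (split _) (cong (score T₀ S v +_)
        (trans (∑-cong {xs = S̄} wins) (trans (∑-const S̄ 1) (*-identityʳ t))))
        where
        wins : ∀ {w} → w ∈ S̄ → 𝟙 (beats T₀ v w) ≡ 1
        wins {w} w∈ = cong 𝟙 (dec-true (key w <? key v)
          (<-≤-trans (≰⇒> (proj₂ (in-S̄ w∈))) (proj₂ (in-S v∈))))

      score-above : ∑ S (score T₀ ws) ≡ triangle s + s * t
      score-above = trans (∑-cong {xs = S} score-S) (trans (∑-+ S (score T₀ S) (λ _ → t))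
        (cong₂ _+_ (handshake T₀ (Unique.filter⁺ _ u)) (∑-const S t)))

      -- The mean score is (s - 1)/2 + t on S and (t - 1)/2 on S̄.  If some target
      -- in S exceeds the former, the window keeps every target in S̄ at least
      -- the latter.
      upper : 2 * ∑ S g + s ≤ s * (s + 2 * t)
      upper with any? (λ v → s + 2 * t ≤? 2 * g v) S
      ... | no none = begin
        2 * ∑ S g + s               ≡⟨ ∑-2f+1 S g ⟨
        ∑ S (λ v → 2 * g v + 1)     ≤⟨ ∑-mono {xs = S} (λ {v} v∈ → subst (_≤ s + 2 * t) (+-comm 1 (2 * g v)) (≰⇒> (none ∘ lose v∈))) ⟩
        ∑ S (λ _ → s + 2 * t)       ≡⟨ ∑-const S _ ⟩
        s * (s + 2 * t)             ∎
      ... | yes some with v , v∈ , large ← find some = +-cancelʳ-≤ (t * t) _ _ (begin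
        2 * ∑ S g + s + t * t                 ≡⟨ cong (2 * ∑ S g + s +_) (∑-const S̄ t) ⟨
        2 * ∑ S g + s + ∑ S̄ (λ _ → t)         ≤⟨ +-monoʳ-≤ (2 * ∑ S g + s) (∑-mono {xs = S̄} beyond) ⟩
        2 * ∑ S g + s + ∑ S̄ (λ w → 2 * g w + 1)  ≡⟨ cong (2 * ∑ S g + s +_) (∑-2f+1 S̄ g) ⟩
        2 * ∑ S g + s + (2 * ∑ S̄ g + t)       ≡⟨ collect (∑ S g) s (∑ S̄ g) t ⟩
        2 * (∑ S g + ∑ S̄ g) + (s + t)         ≡⟨ cong₂ (λ x y → 2 * x + y) (trans (sym (split g)) total) s+t≡N ⟩
        2 * triangle (length ws) + length ws  ≡⟨ 2triangle (length ws) ⟩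
        length ws * length ws                 ≡⟨ cong (λ x → x * x) s+t≡N ⟨
        (s + t) * (s + t)                     ≡⟨ square s t ⟩
        s * (s + 2 * t) + t * t               ∎)
        where
        collect : ∀ x s y t → 2 * x + s + (2 * y + t) ≡ 2 * (x + y) + (s + t)
        collect = solve-∀
        square : ∀ s t → (s + t) * (s + t) ≡ s * (s + 2 * t) + t * t
        square = solve-∀
        beyond : ∀ {w} → w ∈ S̄ → t ≤ 2 * g w + 1
        -- The window costs at most 2k ≤ s + t + 1 of the s + 2t available, which leaves t - 1 for
        -- twice the target of `w`.
        beyond {w} w∈ = +-cancelˡ-≤ (s + t) _ _ (begin
          s + t + t                      ≡⟨ two s t ⟩
          s + 2 * t                      ≤⟨ large ⟩
          2 * g v                        ≤⟨ *-monoʳ-≤ 2 (window (proj₁ (in-S v∈)) (proj₁ (in-S̄ w∈))) ⟩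
          2 * (g w + k)                  ≡⟨ *-distribˡ-+ 2 (g w) k ⟩
          2 * g w + 2 * k                ≤⟨ +-monoʳ-≤ (2 * g w) 2k≤1+N ⟩
          2 * g w + suc (length ws)      ≡⟨ cong (λ x → 2 * g w + suc x) s+t≡N ⟨
          2 * g w + suc (s + t)          ≡⟨ swap (g w) (s + t) ⟩
          s + t + (2 * g w + 1)          ∎)
          where
          two : ∀ s t → s + t + t ≡ s + 2 * t
          two = solve-∀
          swap : ∀ x y → 2 * x + suc y ≡ y + (2 * x + 1)
          swap = solve-∀

  -- The transfers give scores that are at least the targets. Both have the same total, so they
  -- agree everywhere.
  window⇒tournament : ∃[ T ] (∀ {v} → v ∈ ws → score T ws v ≡ g v)
  window⇒tournament with T , ge ← robinHood _ T₀ dominates ≤-refl =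
    T , λ v∈ → sym (∑-mono-tight {xs = ws} ge (trans total (sym (handshake T u))) v∈)

-- Target scores with prescribed residues.

complement : ∀ k .{{_ : NonZero k}} x → ∃[ r ] (r < k × k ∣ x + r)
complement k x = r , m%n<n (x * pred k) k , ∣m+n∣m⇒∣n (subst (k ∣_) eq (m∣m*n x)) (n∣m*n q)
  where
  -- The product x(k - 1) is congruent to -x modulo `k` and needs no subtraction.
  r = x * pred k % k
  q = x * pred k / k
  eq : k * x ≡ q * k + (x + r)
  eq = begin
    k * x                ≡⟨ cong (_* x) (suc-pred k) ⟨
    x + pred k * x       ≡⟨ cong (x +_) (*-comm (pred k) x) ⟩
    x + x * pred k       ≡⟨ cong (x +_) (m≡m%n+[m/n]*n (x * pred k) k) ⟩
    x + (r + q * k)      ≡⟨ +-assoc x r (q * k) ⟨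
    x + r + q * k        ≡⟨ +-comm (x + r) (q * k) ⟩
    q * k + (x + r)      ∎
    where open ≡-Reasoning

∑-∣ : ∀ {A : Set} {k} (xs : List A) {f} → (∀ x → k ∣ f x) → k ∣ ∑ xs f
∑-∣ []       k∣f = _ ∣0
∑-∣ (x ∷ xs) k∣f = ∣m∣n⇒∣m+n (k∣f x) (∑-∣ xs k∣f)

module _ {n} (ws : List (Fin n)) (u : Unique ws) (k : ℕ) .{{_ : NonZero k}}
  (c : Fin n → ℕ)
  where

  private
    record Target (total : ℕ) : Set where
      field
        g       : Fin n → ℕ
        residue : ∀ v → k ∣ c v + g v
        window  : ∀ {v w} → v ∈ ws → w ∈ ws → g v ≤ g w + k
        ∑g≡     : ∑ ws g ≡ total

    some : ∀ {xs : List (Fin n)} → 0 < length xs → Any (λ _ → ⊤) xs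
    some {x ∷ xs} _ = here _

    -- Adding `k` to a smallest target keeps the window, since g m + k ≤ g w + k for every `w`.
    lift : ∀ {s} → 0 < length ws → Target s → Target (s + k)
    lift {s} nonempty t
      with m , m∈ , _ , minimal ←
        maximum {P = λ _ → ⊤} {_≼_ = λ v w → Target.g t w ≤ Target.g t v}
          (λ v w → ≤-total (Target.g t w) (Target.g t v)) (λ p q → ≤-trans q p) (λ _ → yes _) (some nonempty)
      = record
      { g = g′
      ; residue = λ v → residue′ v (v ≟ m)
      ; window = λ {v} {w} v∈ w∈ → window′ v∈ w∈ (v ≟ m) (w ≟ m)
      ; ∑g≡ = +-cancelʳ-≡ (g m) _ _ (begin
          ∑ ws g′ + g m         ≡⟨ ∑-update u m∈ (λ {v} _ v≢m → cong (λ b → if b then g v + k else g v) (dec-false (v ≟ m) v≢m)) ⟩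
          ∑ ws g + g′ m         ≡⟨ cong₂ _+_ ∑g≡ (cong (λ b → if b then g m + k else g m) (dec-true (m ≟ m) refl)) ⟩
          s + (g m + k)         ≡⟨ cong (s +_) (+-comm (g m) k) ⟩
          s + (k + g m)         ≡⟨ +-assoc s k (g m) ⟨
          s + k + g m           ∎)
      }
      where
      open Target t
      open ≡-Reasoning
      g′ : Fin n → ℕ
      g′ v = if does (v ≟ m) then g v + k else g v
      residue′ : ∀ v (d : Dec (v ≡ m)) → k ∣ c v + (if does d then g v + k else g v)
      residue′ v (yes _) = subst (k ∣_) (+-assoc (c v) (g v) k) (∣m∣n⇒∣m+n (residue v) ∣-refl)
      residue′ v (no _)  = residue v
      window′ : ∀ {v w} → v ∈ ws → w ∈ ws → (d : Dec (v ≡ m)) (e : Dec (w ≡ m)) →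
                (if does d then g v + k else g v) ≤ (if does e then g w + k else g w) + k
      window′ v∈ w∈ (yes refl) (yes refl) = m≤m+n _ k
      window′ v∈ w∈ (yes refl) (no _)     = +-monoˡ-≤ k (minimal w∈ _)
      window′ v∈ w∈ (no _)     (yes refl) = ≤-trans (window v∈ w∈) (m≤m+n _ k)
      window′ v∈ w∈ (no _)     (no _)     = window v∈ w∈

    lifts : ∀ h {s} → 0 < length ws → Target s → Target (s + h * k)
    lifts zero    ne t = subst Target (sym (+-identityʳ _)) t
    lifts (suc h) {s} ne t = subst Target (+-assoc s k (h * k)) (lifts h ne (lift ne t))

    r : Fin n → ℕ
    r v = proj₁ (complement k (c v))

    r<k : ∀ v → r v < k
    r<k v = proj₁ (proj₂ (complement k (c v)))

    r-residue : ∀ v → k ∣ c v + r v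
    r-residue v = proj₂ (proj₂ (complement k (c v)))

    initial : Target (∑ ws r)
    initial = record
      { g = r ; residue = r-residue ; ∑g≡ = refl
      ; window = λ {v} {w} _ _ → ≤-trans (<⇒≤ (r<k v)) (m≤n+m k (r w)) }

    N = length ws

    nonempty : 2 * k ≤ suc N → 0 < N
    nonempty 2k≤1+N = s≤s⁻¹ (≤-trans (*-monoʳ-≤ 2 (>-nonZero⁻¹ k)) 2k≤1+N)

    -- Each least residue is at most k - 1, and this is at most the mean score (N - 1)/2.
    ∑r≤triangle : 2 * k ≤ suc N → ∑ ws r ≤ triangle N
    ∑r≤triangle 2k≤1+N = *-cancelˡ-≤ 2 (+-cancelʳ-≤ N _ _ (begin
      2 * ∑ ws r + N              ≡⟨ ∑-2f+1 ws r ⟨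
      ∑ ws (λ v → 2 * r v + 1)    ≤⟨ ∑-mono {xs = ws} (λ {v} _ → 2r+1≤N v) ⟩
      ∑ ws (λ _ → N)              ≡⟨ ∑-const ws N ⟩
      N * N                       ≡⟨ 2triangle N ⟨
      2 * triangle N + N          ∎))
      where
      open ≤-Reasoning
      double : ∀ x → suc (2 * x + 1) ≡ 2 * suc x
      double = solve-∀
      2r+1≤N : ∀ v → 2 * r v + 1 ≤ N
      2r+1≤N v = s≤s⁻¹ (begin
        suc (2 * r v + 1)   ≡⟨ double (r v) ⟩
        2 * suc (r v)       ≤⟨ *-monoʳ-≤ 2 (r<k v) ⟩
        2 * k               ≤⟨ 2k≤1+N ⟩
        suc N               ∎)

    -- Modulo `k`, both `∑ ws r` and `triangle N` are the negative of `∑ ws c`; hence the missing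
    -- total is a whole number of lifts.
    remainder : ∀ {d} → k ∣ ∑ ws c + triangle N → ∑ ws r + d ≡ triangle N → k ∣ d
    remainder {d} k∣ eq = ∣m+n∣m⇒∣n (subst (k ∣_) (begin
      ∑ ws c + triangle N       ≡⟨ cong (∑ ws c +_) eq ⟨
      ∑ ws c + (∑ ws r + d)     ≡⟨ +-assoc (∑ ws c) (∑ ws r) d ⟨
      ∑ ws c + ∑ ws r + d       ∎) k∣)
      (subst (k ∣_) (∑-+ ws c r) (∑-∣ ws r-residue))
      where open ≡-Reasoning

    fromTarget : 2 * k ≤ suc N → Target (triangle N) →
                 ∃[ T ] (∀ {v} → v ∈ ws → k ∣ c v + score T ws v)
    fromTarget 2k≤1+N t =
      let open Target t
          T , scores = window⇒tournament ws u k 2k≤1+N g ∑g≡ window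
      in  T , λ {v} v∈ → subst (λ x → k ∣ c v + x) (sym (scores v∈)) (residue v)

  residueTournament : 2 * k ≤ suc (length ws) → k ∣ ∑ ws c + triangle (length ws) →
                      ∃[ T ] (∀ {v} → v ∈ ws → k ∣ c v + score T ws v)
  residueTournament 2k≤1+N k∣ =
    let d , ∑r+d≡ = m≤n⇒∃[o]m+o≡n (∑r≤triangle 2k≤1+N)
        divides h d≡ = remainder k∣ ∑r+d≡
        reached = subst Target (trans (cong (∑ ws r +_) (sym d≡)) ∑r+d≡)
                    (lifts h (nonempty 2k≤1+N) initial)
    in  fromTarget 2k≤1+N reached

-- Settling vertices one at a time.

addVertex : (v : Fin n) (O : Fin n → Bool) → Tournament n → Tournament n
addVertex {n} v O T = record
  { beats  = λ x y → arc (x ≟ v) (y ≟ v)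
  ; irrefl = λ x → arc-irrefl (x ≟ v)
  ; anti   = λ {x} {y} x≢y → arc-anti x≢y (x ≟ v) (y ≟ v)
  }
  where
  -- `T` also has arcs at `v`; these are overwritten. The decisions are arguments so that the two
  -- laws can be proved by matching on them.
  arc : ∀ {x y} → Dec (x ≡ v) → Dec (y ≡ v) → Bool
  arc         (yes _) (yes _) = false
  arc {y = y} (yes _) (no _)  = O y
  arc {x}     (no _)  (yes _) = not (O x)
  arc {x} {y} (no _)  (no _)  = beats T x y
  arc-irrefl : ∀ {x} (d : Dec (x ≡ v)) → arc d d ≡ false
  arc-irrefl     (yes _) = refl
  arc-irrefl {x} (no _)  = irrefl T x
  arc-anti : ∀ {x y} → x ≢ y → (d : Dec (x ≡ v)) (e : Dec (y ≡ v)) → arc e d ≡ not (arc d e)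
  arc-anti x≢y (yes refl) (yes refl) = contradiction refl x≢y
  arc-anti x≢y (yes _)    (no _)     = refl
  arc-anti x≢y (no _)     (yes _)    = sym (Bool.not-involutive _)
  arc-anti x≢y (no _)     (no _)     = anti T x≢y

module _ {v : Fin n} {O : Fin n → Bool} {T : Tournament n} where

  addVertex-out : ∀ {w} → v ≢ w → beats (addVertex v O T) v w ≡ O w
  addVertex-out {w} v≢w with v ≟ v | w ≟ v
  ... | yes _   | no _     = refl
  ... | no v≢v  | _        = contradiction refl v≢v
  ... | yes _   | yes refl = contradiction refl v≢w

  addVertex-in : ∀ {w} → v ≢ w → beats (addVertex v O T) w v ≡ not (O w)
  addVertex-in v≢w = trans (anti (addVertex v O T) v≢w) (cong not (addVertex-out v≢w))

  addVertex-rest : ∀ {x y} → v ≢ x → v ≢ y → beats (addVertex v O T) x y ≡ beats T x y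
  addVertex-rest {x} {y} v≢x v≢y with x ≟ v | y ≟ v
  ... | no _     | no _     = refl
  ... | yes refl | _        = contradiction refl v≢x
  ... | no _     | yes refl = contradiction refl v≢y

-- F is the set of prescribed arcs, and c v the number of arcs from v to
-- vertices outside ws.
record Orientable (k : ℕ) (F : Fin n → Fin n → Bool) (ws : List (Fin n)) (c : Fin n → ℕ) : Set where
  field
    tournament : Tournament n
    extends    : ∀ {v w} → v ∈ ws → w ∈ ws → F v w ≡ true → beats tournament v w ≡ true
    divisible  : ∀ {v} → v ∈ ws → k ∣ c v + score tournament ws v

open Orientable

-- Of the arcs between `v` and `ws`, those leaving `v` combine with `c v` to a multiple of `k`;
-- those entering it move into the offsets of their tails.
peel-invariant : ∀ {k v} (ws : List (Fin n)) c O →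
                 k ∣ ∑ (v ∷ ws) c + triangle (length (v ∷ ws)) → k ∣ c v + ∑ ws (𝟙 ∘ O) →
                 k ∣ ∑ ws (λ w → c w + 𝟙 (not (O w))) + triangle (length ws)
peel-invariant {k = k} {v} ws c O total k∣ = ∣m+n∣m⇒∣n (subst (k ∣_) (begin
  c v + ∑ ws c + (l + t)                              ≡⟨ cong (λ x → c v + ∑ ws c + (x + t)) l≡ ⟨
  c v + ∑ ws c + (∑ ws (𝟙 ∘ O) + ∑ ws (𝟙 ∘ not ∘ O) + t) ≡⟨ regroup (c v) (∑ ws c) _ _ t ⟩
  c v + ∑ ws (𝟙 ∘ O) + (∑ ws c + ∑ ws (𝟙 ∘ not ∘ O) + t) ≡⟨ cong (λ x → c v + ∑ ws (𝟙 ∘ O) + (x + t)) (∑-+ ws c _) ⟨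
  c v + ∑ ws (𝟙 ∘ O) + (∑ ws (λ w → c w + 𝟙 (not (O w))) + t) ∎) total) k∣
  where
  open ≡-Reasoning
  l = length ws
  t = triangle l
  l≡ : ∑ ws (𝟙 ∘ O) + ∑ ws (𝟙 ∘ not ∘ O) ≡ l
  l≡ = trans (sym (∑-+ ws _ _)) (trans (∑-cong {xs = ws} (λ {w} _ → 𝟙-not (O w)))
         (trans (∑-const ws 1) (*-identityʳ l)))
  regroup : ∀ a b p q t → a + b + (p + q + t) ≡ a + p + (b + q + t)
  regroup = solve-∀

module _ {k : ℕ} {F : Fin n → Fin n → Bool} (F-irrefl : ∀ v → F v v ≡ false) where

  private variable
    c : Fin n → ℕ
    v : Fin n
    O : Fin n → Bool

  -- Once `O` fixes all arcs at `v`, the wins of the other vertices over `v` are booked in their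
  -- offsets, and the same problem remains on `ws`.
  peel : All (v ≢_) ws →
         (∀ {w} → w ∈ ws → F v w ≡ true → O w ≡ true) →
         (∀ {w} → w ∈ ws → F w v ≡ true → O w ≡ false) →
         k ∣ c v + ∑ ws (𝟙 ∘ O) →
         Orientable k F ws (λ w → c w + 𝟙 (not (O w))) → Orientable k F (v ∷ ws) c
  peel {v} {ws} {O} {c} v∉ out in′ k∣ R = record
    { tournament = T
    ; extends    = extends′
    ; divisible  = divisible′
    }
    where
    T = addVertex v O (tournament R)
    extends′ : ∀ {x y} → x ∈ v ∷ ws → y ∈ v ∷ ws → F x y ≡ true → beats T x y ≡ true
    extends′ (here refl) (here refl) f = contradiction (trans (sym f) (F-irrefl v)) λ ()
    extends′ (here refl) (there y∈)  f = trans (addVertex-out (All.lookup v∉ y∈)) (out y∈ f)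
    extends′ (there x∈)  (here refl) f = trans (addVertex-in (All.lookup v∉ x∈)) (cong not (in′ x∈ f))
    extends′ (there x∈)  (there y∈)  f =
      trans (addVertex-rest (All.lookup v∉ x∈) (All.lookup v∉ y∈)) (extends R x∈ y∈ f)
    divisible′ : ∀ {x} → x ∈ v ∷ ws → k ∣ c x + score T (v ∷ ws) x
    divisible′ (here refl) = subst (λ s → k ∣ c v + s) (sym (cong₂ _+_ (cong 𝟙 (irrefl T v))
      (∑-cong {xs = ws} λ w∈ → cong 𝟙 (addVertex-out (All.lookup v∉ w∈))))) k∣
    divisible′ {x} (there x∈) = subst (k ∣_) (trans (+-assoc (c x) _ _) (cong (c x +_) (sym (cong₂ _+_
      (cong 𝟙 (addVertex-in (All.lookup v∉ x∈)))
      (∑-cong {xs = ws} λ w∈ → cong 𝟙 (addVertex-rest (All.lookup v∉ x∈) (All.lookup v∉ w∈)))))))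
      (divisible R x∈)

Unique-++ʳ : ∀ {A : Set} (xs : List A) {ys} → Unique (xs ++ ys) → Unique ys
Unique-++ʳ []       u       = u
Unique-++ʳ (x ∷ xs) (_ ∷ u) = Unique-++ʳ xs u

add : Fin n → (Fin n → Bool) → Fin n → Bool
add z P x = does (x ≟ z) ∨ P x

∑-add : ∀ {P : Fin n → Bool} {z} → Unique ws → z ∈ ws → P z ≡ false →
        ∑ ws (𝟙 ∘ add z P) ≡ suc (∑ ws (𝟙 ∘ P))
∑-add {ws = ws} {P} {z} u z∈ pz = begin
  ∑ ws (𝟙 ∘ add z P)               ≡⟨ +-identityʳ _ ⟨
  ∑ ws (𝟙 ∘ add z P) + 0           ≡⟨ cong (λ b → ∑ ws (𝟙 ∘ add z P) + 𝟙 b) pz ⟨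
  ∑ ws (𝟙 ∘ add z P) + 𝟙 (P z)     ≡⟨ ∑-update u z∈ (λ {x} _ x≢z → cong (λ b → 𝟙 (b ∨ P x)) (dec-false (x ≟ z) x≢z)) ⟩
  ∑ ws (𝟙 ∘ P) + 𝟙 (add z P z)     ≡⟨ cong (λ b → ∑ ws (𝟙 ∘ P) + 𝟙 (b ∨ P z)) (dec-true (z ≟ z) refl) ⟩
  ∑ ws (𝟙 ∘ P) + 1                 ≡⟨ +-comm _ 1 ⟩
  suc (∑ ws (𝟙 ∘ P))               ∎
  where open ≡-Reasoning

-- Vertices of `W` outside `P` are added one by one; `room` ensures that there is always another.
-- Leaving `P` unchanged off `W` is what later protects the arcs prescribed towards the vertex being
-- settled.
enlarge : ∀ {W : List (Fin n)} → Unique ws → Unique W → (∀ {x} → x ∈ W → x ∈ ws) →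
          ∀ r P → ∑ W (𝟙 ∘ P) + r ≤ length W →
          ∃[ O ] ((∀ {x} → P x ≡ true → O x ≡ true) × (∀ {x} → x ∉ W → O x ≡ P x) ×
                  ∑ ws (𝟙 ∘ O) ≡ ∑ ws (𝟙 ∘ P) + r)
enlarge u uW W⊆ws zero    P room = P , id , (λ _ → refl) , sym (+-identityʳ _)
enlarge {ws = ws} {W} u uW W⊆ws (suc r) P room with any? (λ z → P z Bool.≟ false) W
... | no none = contradiction room (<⇒≱ (subst (_< ∑ W (𝟙 ∘ P) + suc r) full (m<m+n _ z<s)))
  where
  full : ∑ W (𝟙 ∘ P) ≡ length W
  full = trans (∑-cong {xs = W} (λ z∈ → cong 𝟙 (Bool.¬-not (none ∘ lose z∈)))) (trans (∑-const W 1) (*-identityʳ _))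
... | yes some with find some
...   | z , z∈ , pz
  with O , P⊆O , elsewhere , total ← enlarge u uW W⊆ws r (add z P)
         (subst (_≤ length W) (trans (+-suc _ r) (cong (_+ r) (sym (∑-add uW z∈ pz)))) room)
  = O , (λ {x} px → P⊆O (trans (cong (does (x ≟ z) ∨_) px) (Bool.∨-zeroʳ _)))
      , (λ {x} x∉ → trans (elsewhere x∉) (cong (_∨ P x) (dec-false (x ≟ z) λ { refl → x∉ z∈ })))
      , trans total (trans (cong (_+ r) (∑-add u (W⊆ws z∈) pz)) (sym (+-suc _ r)))

module _ (k : ℕ) .{{_ : NonZero k}} {F : Fin n → Fin n → Bool} (F-irrefl : ∀ v → F v v ≡ false)
  (F-asym : ∀ {v w} → F v w ≡ true → F w v ≡ false)
  {W : List (Fin n)} (W-free : ∀ {v w} → v ∈ W → F v w ≡ false) (large : 2 * k ≤ suc (length W))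
  where

  -- Each vertex of `C` keeps its prescribed arcs and corrects its residue by extra arcs into `W`.
  -- These conflict with nothing, because no prescribed arc starts in `W`. When `C` is exhausted,
  -- `residueTournament` settles `W`.
  orientSparse : ∀ C → Unique (C ++ W) → (∀ {v} → v ∈ C → ∑ W (𝟙 ∘ F v) + k ≤ suc (length W)) →
                 ∀ c → k ∣ ∑ (C ++ W) c + triangle (length (C ++ W)) → Orientable k F (C ++ W) c
  orientSparse [] u _ c k∣ = record
    { tournament = proj₁ base
    ; extends    = λ v∈ _ f → contradiction (trans (sym f) (W-free v∈)) λ ()
    ; divisible  = proj₂ base
    }
    where base = residueTournament W u k c large k∣
  orientSparse (v ∷ C) (v∉ ∷ u) room c k∣ =
    peel F-irrefl v∉ (λ _ → F⊆O) avoids k∣O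
      (orientSparse C u (room ∘ there) _ (peel-invariant (C ++ W) c O k∣ k∣O))
    where
    free : ∃[ r ] (r < k × k ∣ c v + ∑ (C ++ W) (𝟙 ∘ F v) + r)
    free = complement k _
    r = proj₁ free
    -- The correction `r` is at most k - 1, which is why `room` may compare with `suc (length W)`.
    larger = enlarge u (Unique-++ʳ C u) (∈-++⁺ʳ C) r (F v)
      (s≤s⁻¹ (≤-trans (subst (_≤ ∑ W (𝟙 ∘ F v) + k) (+-suc _ r) (+-monoʳ-≤ _ (proj₁ (proj₂ free)))) (room (here refl))))
    O = proj₁ larger
    F⊆O : ∀ {w} → F v w ≡ true → O w ≡ true
    F⊆O = proj₁ (proj₂ larger)
    avoids : ∀ {w} → w ∈ C ++ W → F w v ≡ true → O w ≡ false
    avoids {w} _ wv = trans (proj₁ (proj₂ (proj₂ larger)) (λ w∈ → contradiction (trans (sym wv) (W-free w∈)) λ ())) (F-asym wv)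
    k∣O : k ∣ c v + ∑ (C ++ W) (𝟙 ∘ O)
    k∣O = subst (k ∣_) (trans (+-assoc (c v) _ r) (cong (c v +_) (sym (proj₂ (proj₂ (proj₂ larger)))))) (proj₂ (proj₂ free))

  -- The first vertex keeps only its prescribed arcs; it need not have any room.
  orient : ∀ x C → Unique (x ∷ C ++ W) → k ∣ ∑ (x ∷ C ++ W) (𝟙 ∘ F x) →
           (∀ {v} → v ∈ C → ∑ W (𝟙 ∘ F v) + k ≤ suc (length W)) →
           k ∣ triangle (length (x ∷ C ++ W)) → Orientable k F (x ∷ C ++ W) (λ _ → 0)
  orient x C (x∉ ∷ u) k∣x room k∣ =
    peel F-irrefl x∉ (λ _ → id) (λ _ → F-asym) k∣F
      (orientSparse C u room _ (peel-invariant {v = x} (C ++ W) (λ _ → 0) (F x)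
        (subst (λ s → k ∣ s + triangle (length (x ∷ C ++ W))) (sym (trans (∑-const (x ∷ C ++ W) 0) (*-zeroʳ (length (x ∷ C ++ W))))) k∣) k∣F))
    where
    k∣F : k ∣ 0 + ∑ (C ++ W) (𝟙 ∘ F x)
    k∣F = subst (λ b → k ∣ 𝟙 b + ∑ (C ++ W) (𝟙 ∘ F x)) (F-irrefl x) k∣x

-- Grouping the arcs at a vertex into stars.

open import Data.Vec.Base as Vec using ([]; _∷_; lookup; here; there)
open import Data.Vec.Properties using ([]=⇒lookup; lookup⇒[]=; lookup∘tabulate)

open Star

record Split (P : Subset n) (q r : ℕ) : Set where
  field
    left right : Subset n
    ∣left∣     : ∣ left ∣ ≡ q
    ∣right∣    : ∣ right ∣ ≡ r
    left⊆      : left ⊆ˢ P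
    right⊆     : right ⊆ˢ P
    separate   : ∀ {x} → x ∈ˢ left → x ∉ˢ right
    covers     : ∀ {x} → x ∈ˢ P → x ∈ˢ left ⊎ x ∈ˢ right

split : (P : Subset n) → ∀ q r → ∣ P ∣ ≡ q + r → Split P q r
split [] zero zero eq = record
  { left = [] ; right = [] ; ∣left∣ = refl ; ∣right∣ = refl
  ; left⊆ = λ () ; right⊆ = λ () ; separate = λ () ; covers = λ () }
split (outside ∷ P) q r eq = record
  { left = outside ∷ left ; right = outside ∷ right ; ∣left∣ = ∣left∣ ; ∣right∣ = ∣right∣
  ; left⊆ = λ { (there x∈) → there (left⊆ x∈) }
  ; right⊆ = λ { (there x∈) → there (right⊆ x∈) }
  ; separate = λ { (there x∈) (there x∈′) → separate x∈ x∈′ }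
  ; covers = λ { (there x∈) → [ inj₁ ∘ there , inj₂ ∘ there ]′ (covers x∈) } }
  where open Split (split P q r eq)
split (inside ∷ P) (suc q) r eq = record
  { left = inside ∷ left ; right = outside ∷ right ; ∣left∣ = cong suc ∣left∣ ; ∣right∣ = ∣right∣
  ; left⊆ = λ { here → here ; (there x∈) → there (left⊆ x∈) }
  ; right⊆ = λ { (there x∈) → there (right⊆ x∈) }
  ; separate = λ { (there x∈) (there x∈′) → separate x∈ x∈′ }
  ; covers = λ { here → inj₁ here ; (there x∈) → [ inj₁ ∘ there , inj₂ ∘ there ]′ (covers x∈) } }
  where open Split (split P q r (suc-injective eq))
split (inside ∷ P) zero (suc r) eq = record
  { left = outside ∷ left ; right = inside ∷ right ; ∣left∣ = ∣left∣ ; ∣right∣ = cong suc ∣right∣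
  ; left⊆ = λ { (there x∈) → there (left⊆ x∈) }
  ; right⊆ = λ { here → here ; (there x∈) → there (right⊆ x∈) }
  ; separate = λ { (there x∈) (there x∈′) → separate x∈ x∈′ }
  ; covers = λ { here → inj₂ here ; (there x∈) → [ inj₁ ∘ there , inj₂ ∘ there ]′ (covers x∈) } }
  where open Split (split P zero r (suc-injective eq))

Arc : Star n k → Fin n → Fin n → Set
Arc S x y = x ≡ centre S × y ∈ˢ leaves S

Arc-irrefl : (S : Star n k) → ∀ {x} → ¬ Arc S x x
Arc-irrefl (star _ _ centre∉ _) (refl , c∈) = ⊥-elim-irr (centre∉ c∈)

-- The field `numberOfLeaves` is irrelevant; decidability of the equation makes it usable again.
∣leaves∣ : (S : Star n k) → ∣ leaves S ∣ ≡ k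
∣leaves∣ {k = k} (star _ L _ ∣L∣≡k) = recompute (∣ L ∣ ℕ.≟ k) ∣L∣≡k

edgeDisjoint : (S S′ : Star n k) → (∀ {x y} → Arc S x y → ¬ Arc S′ x y) →
               (∀ {x y} → Arc S x y → ¬ Arc S′ y x) → EdgeDisjoint S S′
edgeDisjoint S S′ same opposite x y (inj₁ xy , inj₁ xy′) = same xy xy′
edgeDisjoint S S′ same opposite x y (inj₁ xy , inj₂ yx′) = opposite xy yx′
edgeDisjoint S S′ same opposite x y (inj₂ yx , inj₁ xy′) = opposite yx xy′
edgeDisjoint S S′ same opposite x y (inj₂ yx , inj₂ yx′) = same yx yx′

record StarsAt (k : ℕ) (v : Fin n) (P : Subset n) : Set where
  field
    list     : List (Star n k)
    apart    : AllPairs EdgeDisjoint list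
    sound    : ∀ {S} → S ∈ list → centre S ≡ v × leaves S ⊆ˢ P
    covers   : ∀ {w} → w ∈ˢ P → Any (λ S → Arc S v w) list

-- Leaves are cut off `k` at a time. Stars at the same centre with separate leaves share no edge,
-- because `v` is not among the leaves.
starsAt : ∀ (v : Fin n) q (P : Subset n) → v ∉ˢ P → ∣ P ∣ ≡ q * k →
          Σ[ 𝒮 ∈ StarsAt k v P ] length (StarsAt.list 𝒮) ≡ q
starsAt v zero P v∉ eq = record
  { list = [] ; apart = [] ; sound = λ () ; covers = λ w∈ → ⊥-elim (empty P eq w∈) } , refl
  where
  empty : ∀ {n} (P : Subset n) {w} → ∣ P ∣ ≡ 0 → w ∉ˢ P
  empty (outside ∷ P) eq (there w∈) = empty P eq w∈
starsAt {n} {k} v (suc q) P v∉ eq = record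
  { list     = S ∷ R.list
  ; apart    = All.tabulate new ∷ R.apart
  ; sound    = λ { (here refl) → refl , left⊆
                 ; (there S∈)  → proj₁ (R.sound S∈) , right⊆ ∘ proj₂ (R.sound S∈) }
  ; covers   = λ w∈ → [ (λ w∈L → here (refl , w∈L)) , there ∘ R.covers ]′ (covers w∈)
  } , cong suc (proj₂ rest)
  where
  open Split (split P k (q * k) eq)
  rest = starsAt v q right (v∉ ∘ right⊆) ∣right∣
  module R = StarsAt (proj₁ rest)
  S : Star n k
  S = star v left (v∉ ∘ left⊆) ∣left∣
  new : ∀ {S′} → S′ ∈ R.list → EdgeDisjoint S S′
  new {S′} S′∈ = edgeDisjoint S S′
    (λ { (refl , y∈) (_ , y∈′) → separate y∈ (proj₂ (R.sound S′∈) y∈′) })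
    (λ { (refl , y∈) (refl , v∈) → v∉ (right⊆ (proj₂ (R.sound S′∈) v∈)) })

∑-allFin : ∀ n (f : Fin (suc n) → ℕ) → ∑ (allFin (suc n)) f ≡ f zero + ∑ (allFin n) (f ∘ suc)
∑-allFin n f = cong (λ xs → f zero + sum xs)
  (trans (map-tabulate suc f) (sym (map-tabulate id (f ∘ suc))))

∣p∣≡∑ : (p : Subset n) → ∣ p ∣ ≡ ∑ (allFin n) (𝟙 ∘ lookup p)
∣p∣≡∑ []            = refl
∣p∣≡∑ {suc n} (inside  ∷ p) = trans (cong suc (∣p∣≡∑ p)) (sym (∑-allFin n (𝟙 ∘ lookup (inside ∷ p))))
∣p∣≡∑ {suc n} (outside ∷ p) = trans (∣p∣≡∑ p) (sym (∑-allFin n (𝟙 ∘ lookup (outside ∷ p))))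

-- The arcs prescribed by a partial design.

isCentre : Fin n → Star n k → Bool
isCentre v S = does (v ≟ centre S)

arcᵇ : List (Star n k) → Fin n → Fin n → Bool
arcᵇ []       v w = false
arcᵇ (S ∷ 𝒮) v w = (isCentre v S ∧ lookup (leaves S) w) ∨ arcᵇ 𝒮 v w

starsAtCount : List (Star n k) → Fin n → ℕ
starsAtCount 𝒮 v = ∑ 𝒮 (𝟙 ∘ isCentre v)

∧-true : ∀ {a b} → a ∧ b ≡ true → a ≡ true × b ≡ true
∧-true {true} {true} _ = refl , refl

∧ᵇ⇒Arc : ∀ (S : Star n k) {v w} → isCentre v S ∧ lookup (leaves S) w ≡ true → Arc S v w
∧ᵇ⇒Arc S {v} {w} eq with v ≟ centre S
... | yes v≡c = v≡c , lookup⇒[]= w (leaves S) eq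

Arc⇒∧ᵇ : ∀ (S : Star n k) {v w} → Arc S v w → isCentre v S ∧ lookup (leaves S) w ≡ true
Arc⇒∧ᵇ S {v} (v≡c , w∈) = cong₂ _∧_ (dec-true (v ≟ centre S) v≡c) ([]=⇒lookup w∈)

arcᵇ⇒Any : ∀ (𝒮 : List (Star n k)) {v w} → arcᵇ 𝒮 v w ≡ true → Any (λ S → Arc S v w) 𝒮
arcᵇ⇒Any (S ∷ 𝒮) {v} {w} eq with isCentre v S ∧ lookup (leaves S) w in arc
... | true  = here (∧ᵇ⇒Arc S arc)
... | false = there (arcᵇ⇒Any 𝒮 eq)

Any⇒arcᵇ : ∀ (𝒮 : List (Star n k)) {v w} → Any (λ S → Arc S v w) 𝒮 → arcᵇ 𝒮 v w ≡ true
Any⇒arcᵇ (S ∷ 𝒮) (here arc)  = cong (_∨ _) (Arc⇒∧ᵇ S arc)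
Any⇒arcᵇ (S ∷ 𝒮) (there any) = trans (cong (_ ∨_) (Any⇒arcᵇ 𝒮 any)) (Bool.∨-zeroʳ _)

arcᵇ-irrefl : ∀ (𝒮 : List (Star n k)) v → arcᵇ 𝒮 v v ≡ false
arcᵇ-irrefl 𝒮 v with arcᵇ 𝒮 v v in eq
... | false = refl
... | true with S , _ , arc ← find (arcᵇ⇒Any 𝒮 eq) = contradiction arc (Arc-irrefl S)

sameStar : ∀ {𝒮 : List (Star n k)} → AllPairs EdgeDisjoint 𝒮 → ∀ {S S′ x y} → S ∈ 𝒮 → S′ ∈ 𝒮 →
           HasEdge S x y → HasEdge S′ x y → S ≡ S′
sameStar (_  ∷ _)  (here refl) (here refl) _ _  = refl
sameStar (S# ∷ _)  (here refl) (there S′∈) e e′ = contradiction (e , e′) (All.lookup S# S′∈ _ _)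
sameStar (S# ∷ _)  (there S∈)  (here refl) e e′ = contradiction (e′ , e) (All.lookup S# S∈ _ _)
sameStar (_  ∷ ds) (there S∈)  (there S′∈) e e′ = sameStar ds S∈ S′∈ e e′

-- Opposite arcs lie on one edge, hence in one star, whose centre would then be one of its leaves.
arcᵇ-asym : ∀ {𝒮 : List (Star n k)} → AllPairs EdgeDisjoint 𝒮 → ∀ {v w} →
            arcᵇ 𝒮 v w ≡ true → arcᵇ 𝒮 w v ≡ false
arcᵇ-asym {𝒮 = 𝒮} ds {v} {w} vw with arcᵇ 𝒮 w v in wv
... | false = refl
... | true with S , S∈ , arc ← find (arcᵇ⇒Any 𝒮 vw) | S′ , S′∈ , arc′ ← find (arcᵇ⇒Any 𝒮 wv)
  with refl ← sameStar ds S∈ S′∈ (inj₁ arc) (inj₂ arc′)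
  = contradiction (proj₁ arc′ , proj₂ arc) (Arc-irrefl S)

𝟙-∨ : ∀ a b → (a ≡ true → b ≡ false) → 𝟙 (a ∨ b) ≡ 𝟙 a + 𝟙 b
𝟙-∨ true  b disj = cong suc (sym (cong 𝟙 (disj refl)))
𝟙-∨ false b disj = refl

-- Edge-disjoint stars with a common centre have no common leaf, so the disjunction in `arcᵇ` counts
-- as a sum.
∑-arcᵇ : ∀ {𝒮 : List (Star n k)} → AllPairs EdgeDisjoint 𝒮 → ∀ v →
         ∑ (allFin n) (𝟙 ∘ arcᵇ 𝒮 v) ≡ starsAtCount 𝒮 v * k
∑-arcᵇ {n} [] v = trans (∑-const (allFin n) 0) (*-zeroʳ (length (allFin n)))
∑-arcᵇ {n} {k} {S ∷ 𝒮} (S# ∷ ds) v = begin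
  ∑ (allFin n) (𝟙 ∘ arcᵇ (S ∷ 𝒮) v)
    ≡⟨ ∑-cong {xs = allFin n} (λ {w} _ → 𝟙-∨ _ (arcᵇ 𝒮 v w) (exclusive w)) ⟩
  ∑ (allFin n) (λ w → 𝟙 (isCentre v S ∧ lookup (leaves S) w) + 𝟙 (arcᵇ 𝒮 v w))
    ≡⟨ ∑-+ (allFin n) _ _ ⟩
  ∑ (allFin n) (λ w → 𝟙 (isCentre v S ∧ lookup (leaves S) w)) + ∑ (allFin n) (𝟙 ∘ arcᵇ 𝒮 v)
    ≡⟨ cong₂ _+_ (first (isCentre v S)) (∑-arcᵇ ds v) ⟩
  𝟙 (isCentre v S) * k + starsAtCount 𝒮 v * k
    ≡⟨ *-distribʳ-+ k (𝟙 (isCentre v S)) _ ⟨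
  starsAtCount (S ∷ 𝒮) v * k ∎
  where
  open ≡-Reasoning
  exclusive : ∀ w → isCentre v S ∧ lookup (leaves S) w ≡ true → arcᵇ 𝒮 v w ≡ false
  exclusive w arc with arcᵇ 𝒮 v w in eq
  ... | false = refl
  ... | true with S′ , S′∈ , arc′ ← find (arcᵇ⇒Any 𝒮 eq) =
    contradiction (inj₁ (∧ᵇ⇒Arc S arc) , inj₁ arc′) (All.lookup S# S′∈ v w)
  first : ∀ b → ∑ (allFin n) (λ w → 𝟙 (b ∧ lookup (leaves S) w)) ≡ 𝟙 b * k
  first true  = trans (sym (∣p∣≡∑ (leaves S))) (trans (∣leaves∣ S) (sym (+-identityʳ k)))
  first false = trans (∑-const (allFin n) 0) (*-zeroʳ (length (allFin n)))

∑-starsAtCount : ∀ (𝒮 : List (Star n k)) → ∑ (allFin n) (starsAtCount 𝒮) ≡ length 𝒮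
∑-starsAtCount {n} []       = trans (∑-const (allFin n) 0) (*-zeroʳ (length (allFin n)))
∑-starsAtCount {n} (S ∷ 𝒮) = trans (∑-+ (allFin n) _ _)
  (cong₂ _+_ (∑-indicator (Unique.allFin⁺ n) (∈-allFin (centre S))) (∑-starsAtCount 𝒮))

-- From a tournament to a completion.

module _ (𝒜 : PartialDesign n k) (T : Tournament n)
  (contains : ∀ {v w} → arcᵇ (stars 𝒜) v w ≡ true → beats T v w ≡ true)
  (k∣score : ∀ v → k ∣ score T (allFin n) v)
  where

  private
    F = arcᵇ (stars 𝒜)

    remaining : Fin n → Subset n
    remaining v = Vec.tabulate (λ w → beats T v w ∧ not (F v w))

    lookup-remaining : ∀ v w → lookup (remaining v) w ≡ beats T v w ∧ not (F v w)
    lookup-remaining v = lookup∘tabulate _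

    remaining⁻ : ∀ {v w} → w ∈ˢ remaining v → beats T v w ≡ true × not (F v w) ≡ true
    remaining⁻ {v} {w} w∈ = ∧-true (trans (sym (lookup-remaining v w)) ([]=⇒lookup w∈))

    -- Both the score of `v` and the number of its prescribed arcs are multiples of `k`.
    ∣remaining∣ : ∀ v → k ∣ ∣ remaining v ∣
    ∣remaining∣ v = ∣m+n∣m⇒∣n (subst (k ∣_) (begin
      score T (allFin n) v
        ≡⟨ ∑-cong {xs = allFin n} (λ {w} _ → pointwise (F v w) (beats T v w) contains) ⟩
      ∑ (allFin n) (λ w → 𝟙 (F v w) + 𝟙 (beats T v w ∧ not (F v w)))
        ≡⟨ ∑-+ (allFin n) _ _ ⟩
      ∑ (allFin n) (𝟙 ∘ F v) + ∑ (allFin n) (λ w → 𝟙 (beats T v w ∧ not (F v w)))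
        ≡⟨ cong₂ _+_ (∑-arcᵇ (disjoint 𝒜) v)
             (trans (∑-cong {xs = allFin n} (λ {w} _ → cong 𝟙 (sym (lookup-remaining v w)))) (sym (∣p∣≡∑ (remaining v)))) ⟩
      starsAtCount (stars 𝒜) v * k + ∣ remaining v ∣ ∎) (k∣score v)) (n∣m*n (starsAtCount (stars 𝒜) v))
      where
      open ≡-Reasoning
      pointwise : ∀ f b → (f ≡ true → b ≡ true) → 𝟙 b ≡ 𝟙 f + 𝟙 (b ∧ not f)
      pointwise true  b f⇒b = trans (cong 𝟙 (f⇒b refl)) (cong (suc ∘ 𝟙) (sym (Bool.∧-zeroʳ b)))
      pointwise false b _   = cong 𝟙 (sym (Bool.∧-identityʳ b))

    new : ∀ v → StarsAt k v (remaining v)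
    new v with ∣remaining∣ v
    ... | divides q eq = proj₁ (starsAt v q (remaining v)
      (λ v∈ → contradiction (trans (sym (irrefl T v)) (proj₁ (remaining⁻ v∈))) λ ()) eq)

    newStars = concat (tabulate (StarsAt.list ∘ new))

    new-arc : ∀ {v S} → S ∈ StarsAt.list (new v) → ∀ {x y} → Arc S x y →
              x ≡ v × beats T x y ≡ true × not (F x y) ≡ true
    new-arc {v} S∈ (refl , y∈) with refl , ⊆remaining ← StarsAt.sound (new v) S∈ =
      refl , remaining⁻ (⊆remaining y∈)

    no2cycle : ∀ {x y} → beats T x y ≡ true → ¬ beats T y x ≡ true
    no2cycle {x} {y} xy yx with x ≟ y
    ... | yes refl = contradiction (trans (sym (irrefl T x)) xy) λ ()
    ... | no x≢y   = contradiction (trans (sym (trans (anti T x≢y) (cong not xy))) yx) λ ()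

    old-arc : ∀ {S} → S ∈ stars 𝒜 → ∀ {x y} → Arc S x y → F x y ≡ true
    old-arc S∈ arc = Any⇒arcᵇ (stars 𝒜) (lose S∈ arc)

    -- A common arc would have two tails, and a pair of opposite arcs would be a 2-cycle of the
    -- tournament.
    new-new : ∀ {v w} → v ≢ w → All (λ S → All (EdgeDisjoint S) (StarsAt.list (new w))) (StarsAt.list (new v))
    new-new v≢w = All.tabulate λ {S} S∈ → All.tabulate λ {S′} S′∈ → edgeDisjoint S S′
      (λ arc arc′ → v≢w (trans (sym (proj₁ (new-arc S∈ arc))) (proj₁ (new-arc S′∈ arc′))))
      (λ arc arc′ → no2cycle (proj₁ (proj₂ (new-arc S∈ arc))) (proj₁ (proj₂ (new-arc S′∈ arc′))))

    fromNew : ∀ {S} → S ∈ newStars → ∃[ v ] S ∈ StarsAt.list (new v)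
    fromNew {S} S∈ =
      let _ , S∈xs , xs∈ = ∈-concat⁻′ (tabulate (StarsAt.list ∘ new)) S∈
          v , xs≡ = ∈-tabulate⁻ {f = StarsAt.list ∘ new} xs∈
      in  v , subst (S ∈_) xs≡ S∈xs

    old-new : ∀ {S S′} → S ∈ stars 𝒜 → (∃[ v ] S′ ∈ StarsAt.list (new v)) → EdgeDisjoint S S′
    old-new {S} {S′} S∈ (v , S′∈) = edgeDisjoint S S′
      (λ arc arc′ → contradiction (trans (sym (cong not (old-arc S∈ arc))) (proj₂ (proj₂ (new-arc S′∈ arc′)))) λ ())
      (λ arc arc′ → no2cycle (contains (old-arc S∈ arc)) (proj₁ (proj₂ (new-arc S′∈ arc′))))

    ℬ : PartialDesign n k
    ℬ = partialDesign (stars 𝒜 ++ newStars)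
      (AllPairs.++⁺ (disjoint 𝒜)
        (AllPairs.concat⁺ (All.tabulate⁺ (StarsAt.apart ∘ new)) (AllPairs.tabulate⁺ new-new))
        (All.tabulate λ S∈ → All.tabulate (old-new S∈ ∘ fromNew)))

    covered : ∀ {x y} → beats T x y ≡ true → Any (λ S → Arc S x y) (stars ℬ)
    covered {x} {y} xy = by (F x y) refl
      where
      by : ∀ b → F x y ≡ b → Any (λ S → Arc S x y) (stars ℬ)
      by true  eq = Any.++⁺ˡ (arcᵇ⇒Any (stars 𝒜) eq)
      by false eq = Any.++⁺ʳ (stars 𝒜) (Any.concat⁺ (lose (∈-tabulate⁺ x) (StarsAt.covers (new x)
        (lookup⇒[]= y _ (trans (lookup-remaining x y) (cong₂ (λ a b → a ∧ not b) xy eq))))))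

  tournament⇒completion : HasCompletion 𝒜
  tournament⇒completion = ℬ , isDesign , ∈-++⁺ˡ
    where
    isDesign : IsDesign ℬ
    isDesign x y x≢y = by (beats T x y) refl
      where
      by : ∀ b → beats T x y ≡ b → Any (λ S → HasEdge S x y) (stars ℬ)
      by true  xy = Any.map inj₁ (covered xy)
      by false xy = Any.map inj₂ (covered (trans (anti T x≢y) (cong not xy)))

-- Arithmetic of the bound.

C2≡triangle : ∀ n → n choose 2 ≡ triangle n
C2≡triangle zero    = refl
C2≡triangle (suc n) = trans (sym (nCk+nC[k+1]≡[n+1]C[k+1] n 1)) (cong₂ _+_ (nC1≡n n) (C2≡triangle n))

-- The hypothesis a ≤ u n k for n = 2 + (j + m * k) and j < k; here j + 1 = k
-- is the case n ≡ 1 (mod k).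
Bound : (k m j a : ℕ) → Set
Bound k m j a = suc a ≤ 2 * m ⊎ (suc j ≡ k × a ≤ 2 * m)

≤-slack : ∀ {a b} c → a + c ≡ b → a ≤ b
≤-slack {a} c refl = m≤m+n a c

module _ where

  open ≤-Reasoning

  -- In the next two lemmas p counts the centres other than the busiest one.
  baseRoom : ∀ {k} m j {a p} → 2 ≤ k → Bound k m j a → 2 * k ≤ 2 + (j + m * k) →
             p ≡ 0 ⊎ suc p ≤ a → p + 2 * k ≤ 2 + (j + m * k)
  baseRoom m j k≥2 _ 2k≤n (inj₁ refl) = 2k≤n
  -- Under the first alternative p ≤ 2m - 2. This is impossible for m = 0 and gives p = 0 for m = 1.
  -- From there each further unit of m adds 2 to the bound on p, but k ≥ 2 to the order.
  baseRoom {suc (suc k)} zero j {p = p} (s≤s (s≤s _)) (inj₁ a<) 2k≤n (inj₂ p<a) = contradiction a< λ ()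
  baseRoom {suc (suc k)} (suc zero) j {p = p} (s≤s (s≤s _)) (inj₁ a<) 2k≤n (inj₂ p<a)
    with z≤n ← s≤s⁻¹ (s≤s⁻¹ (≤-trans (s≤s p<a) a<)) = 2k≤n
  baseRoom {suc (suc k)} (suc (suc m)) j {p = p} (s≤s (s≤s _)) (inj₁ a<) 2k≤n (inj₂ p<a) = begin
    p + 2 * (2 + k)                 ≤⟨ +-monoˡ-≤ _ (+-cancelˡ-≤ 2 _ _ (≤-trans (≤-trans (s≤s p<a) a<) (≤-reflexive (two m)))) ⟩
    2 + 2 * m + 2 * (2 + k)         ≤⟨ ≤-slack (j + m * k) (slack m k j) ⟩
    2 + (j + (2 + m) * (2 + k))     ∎
    where
    two : ∀ m → 2 * (2 + m) ≡ 2 + (2 + 2 * m)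
    two = solve-∀
    slack : ∀ m k j → 2 + 2 * m + 2 * (2 + k) + (j + m * k) ≡ 2 + (j + (2 + m) * (2 + k))
    slack = solve-∀
  baseRoom {suc (suc k)} zero j (s≤s (s≤s _)) (inj₂ (_ , z≤n)) 2k≤n (inj₂ ())
  -- Under the second alternative p ≤ 2m - 1. For m = 1 the order is 2k + 1, so p = 1 attains
  -- equality.
  baseRoom {suc (suc k)} (suc zero) _ {p = p} (s≤s (s≤s _)) (inj₂ (refl , a≤)) 2k≤n (inj₂ p<a) = begin
    p + 2 * (2 + k)                 ≤⟨ +-monoˡ-≤ _ (s≤s⁻¹ (≤-trans p<a a≤)) ⟩
    1 + 2 * (2 + k)                 ≡⟨ exact k ⟩
    2 + (suc k + 1 * (2 + k))       ∎
    where
    exact : ∀ k → 1 + 2 * (2 + k) ≡ 2 + (suc k + 1 * (2 + k))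
    exact = solve-∀
  baseRoom {suc (suc k)} (suc (suc m)) _ {p = p} (s≤s (s≤s _)) (inj₂ (refl , a≤)) 2k≤n (inj₂ p<a) = begin
    p + 2 * (2 + k)                 ≤⟨ +-monoˡ-≤ _ (+-cancelˡ-≤ 1 _ _ (≤-trans (≤-trans p<a a≤) (≤-reflexive (two m)))) ⟩
    3 + 2 * m + 2 * (2 + k)         ≤⟨ ≤-slack (k + m * k) (slack m k) ⟩
    2 + (suc k + (2 + m) * (2 + k)) ∎
    where
    two : ∀ m → 2 * (2 + m) ≡ 1 + (3 + 2 * m)
    two = solve-∀
    slack : ∀ m k → 3 + 2 * m + 2 * (2 + k) + (k + m * k) ≡ 2 + (suc k + (2 + m) * (2 + k))
    slack = solve-∀

  centreRoom : ∀ {k} m j {a p} x → 2 ≤ k → Bound k m j a → 1 ≤ p → 2 * x + p ≤ suc a →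
               x * k + k + p ≤ 2 + (j + m * k)
  centreRoom {suc (suc k)} m j {a} {p} x (s≤s (s≤s _)) (inj₁ a<) 1≤p le
    -- With m = x + 1 + f the hypotheses give p ≤ 2 + 2f, and 2f ≤ fk.
    with f , refl ← m≤n⇒∃[o]m+o≡n (*-cancelˡ-< 2 x m (≤-trans
      (subst (_≤ 2 * x + p) (+-comm _ 1) (+-monoʳ-≤ (2 * x) 1≤p)) (≤-trans le a<)))
    = begin
    x * (2 + k) + (2 + k) + p             ≤⟨ +-monoʳ-≤ (x * (2 + k) + (2 + k)) (+-cancelˡ-≤ (2 * x) _ _
                                             (≤-trans (≤-trans le a<) (≤-reflexive (two x f)))) ⟩
    x * (2 + k) + (2 + k) + (2 + 2 * f)   ≤⟨ ≤-slack (j + f * k) (slack x f k j) ⟩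
    2 + (j + (suc x + f) * (2 + k))       ∎
    where
    two : ∀ x f → 2 * (suc x + f) ≡ 2 * x + (2 + 2 * f)
    two = solve-∀
    slack : ∀ x f k j → x * (2 + k) + (2 + k) + (2 + 2 * f) + (j + f * k) ≡ 2 + (j + (suc x + f) * (2 + k))
    slack = solve-∀
  centreRoom {suc (suc k)} m _ {a} {p} x (s≤s (s≤s _)) (inj₂ (refl , a≤)) 1≤p le
    -- Now only x ≤ m is available. With m = x + f one has p ≤ 1 + 2f, and j = k - 1 supplies the
    -- summand k that the previous case took from m.
    with f , refl ← m≤n⇒∃[o]m+o≡n (*-cancelˡ-≤ {x} {m} 2 (s≤s⁻¹ (≤-trans
      (subst (_≤ 2 * x + p) (+-comm _ 1) (+-monoʳ-≤ (2 * x) 1≤p)) (≤-trans le (s≤s a≤)))))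
    = begin
    x * (2 + k) + (2 + k) + p             ≤⟨ +-monoʳ-≤ (x * (2 + k) + (2 + k)) (+-cancelˡ-≤ (2 * x) _ _
                                             (≤-trans (≤-trans le (s≤s a≤)) (≤-reflexive (two x f)))) ⟩
    x * (2 + k) + (2 + k) + (1 + 2 * f)   ≤⟨ ≤-slack (f * k) (slack x f k) ⟩
    2 + (suc k + (x + f) * (2 + k))       ∎
    where
    two : ∀ x f → suc (2 * (x + f)) ≡ 2 * x + (1 + 2 * f)
    two = solve-∀
    slack : ∀ x f k → x * (2 + k) + (2 + k) + (1 + 2 * f) + f * k ≡ 2 + (suc k + (x + f) * (2 + k))
    slack = solve-∀

-- Each entry other than `x` contributes at least 1.
length+∈≤∑ : ∀ {A : Set} {xs : List A} {f x} → (∀ {y} → y ∈ xs → 1 ≤ f y) → x ∈ xs →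
             f x + length xs ≤ suc (∑ xs f)
length+∈≤∑ {xs = y ∷ xs} {f} f≥1 (here refl) = begin
  f y + suc (length xs)   ≡⟨ +-suc (f y) _ ⟩
  suc (f y + length xs)   ≤⟨ s≤s (+-monoʳ-≤ (f y) length≤∑) ⟩
  suc (f y + ∑ xs f)      ∎
  where
  open ≤-Reasoning
  length≤∑ : length xs ≤ ∑ xs f
  length≤∑ = ≤-trans (≤-reflexive (sym (trans (∑-const xs 1) (*-identityʳ _)))) (∑-mono {xs = xs} (f≥1 ∘ there))
length+∈≤∑ {xs = y ∷ xs} {f} {x} f≥1 (there x∈) = begin
  f x + suc (length xs)   ≡⟨ +-suc (f x) _ ⟩
  suc (f x + length xs)   ≤⟨ s≤s (length+∈≤∑ (f≥1 ∘ there) x∈) ⟩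
  suc (suc (∑ xs f))      ≤⟨ s≤s (+-monoˡ-≤ (∑ xs f) (f≥1 (here refl))) ⟩
  suc (f y + ∑ xs f)      ∎
  where open ≤-Reasoning

-- Completing a partial design with few stars.

module _ {k : ℕ} .{{_ : NonZero k}} (k≥2 : 2 ≤ k) (m j : ℕ) where

  private
    order = 2 + (j + m * k)

  module _ (k∣nC2 : k ∣ order choose 2) (2k≤n : 2 * k ≤ order) (𝒜 : PartialDesign order k)
    (bound : Bound k m j (size 𝒜)) where

    private
      a : Fin order → ℕ
      a = starsAtCount (stars 𝒜)

      F : Fin order → Fin order → Bool
      F = arcᵇ (stars 𝒜)

      busiest : ∃[ x ] (x ∈ allFin order × ⊤ × (∀ {v} → v ∈ allFin order → ⊤ → a v ≤ a x))
      busiest = maximum {P = λ _ → ⊤} {_≼_ = λ v w → a v ≤ a w} (λ v w → ≤-total (a v) (a w)) ≤-trans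
        (λ _ → yes _) (here _)

      x₀ : Fin order
      x₀ = proj₁ busiest

      a≤ : ∀ v → a v ≤ a x₀
      a≤ v = proj₂ (proj₂ (proj₂ busiest)) (∈-allFin v) _

      module _ {ys zs} (allFin≡ : allFin order ≡ ys ++ x₀ ∷ zs) where

        -- `C` holds the centres other than `x₀`, and `W` the non-centres other than `x₀`. The
        -- vertex `x₀` is set apart even if there are no stars at all.
        C W vs : List (Fin order)
        C = filter (λ v → 1 ≤? a v) (ys ++ zs)
        W = filter (λ v → ¬? (1 ≤? a v)) (ys ++ zs)
        vs = x₀ ∷ C ++ W

        vs↭ : allFin order ↭ vs
        vs↭ = ↭-trans (↭-reflexive allFin≡) (↭-trans (Perm.shift x₀ ys zs)
                (↭-prep x₀ (filter-↭ (λ v → 1 ≤? a v) (ys ++ zs))))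

        unique : Unique vs
        unique = Unique-resp-↭ vs↭ (Unique.allFin⁺ order)

        length-vs : length vs ≡ order
        length-vs = trans (sym (Perm.↭-length vs↭)) (length-tabulate id)

        n≡ : suc (length C + length W) ≡ order
        n≡ = trans (cong suc (sym (length-++ C))) length-vs

        C-centre : ∀ {v} → v ∈ C → 1 ≤ a v
        C-centre v∈ = proj₂ (∈-filter⁻ (λ v → 1 ≤? a v) {xs = ys ++ zs} v∈)

        W-free : ∀ {v w} → v ∈ W → F v w ≡ false
        W-free {v} {w} v∈ = noArc (F v w) refl
          where
          a≡0 : a v ≡ 0
          a≡0 = n<1⇒n≡0 (≰⇒> (proj₂ (∈-filter⁻ (λ v → ¬? (1 ≤? a v)) {xs = ys ++ zs} v∈)))
          noArc : ∀ b → F v w ≡ b → b ≡ false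
          noArc false _  = refl
          noArc true  vw = contradiction
            (trans (∑-arcᵇ (disjoint 𝒜) v) (cong (_* k) a≡0))
            (≢-sym (<⇒≢ (≤-<-trans z≤n (∑-mono-strict {xs = allFin order} {f = λ _ → 0} {𝟙 ∘ F v} (λ _ → z≤n) (∈-allFin w)
               (subst (λ b → 0 < 𝟙 b) (sym vw) z<s)))))

        stars-total : a x₀ + ∑ C a ≤ size 𝒜
        stars-total = begin
          a x₀ + ∑ C a              ≤⟨ +-monoʳ-≤ (a x₀) (m≤m+n (∑ C a) (∑ W a)) ⟩
          a x₀ + (∑ C a + ∑ W a)    ≡⟨ cong (a x₀ +_) (∑-++ C W a) ⟨
          ∑ vs a                    ≡⟨ ∑-↭ a vs↭ ⟨
          ∑ (allFin order) a            ≡⟨ ∑-starsAtCount (stars 𝒜) ⟩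
          size 𝒜                    ∎
          where open ≤-Reasoning

        -- One copy of `a v` is charged to `x₀`, which has at least as many stars, and the other to
        -- `v` itself; every further member of `C` pays for its own place with a star.
        C-load : ∀ {v} → v ∈ C → 2 * a v + length C ≤ suc (size 𝒜)
        C-load {v} v∈ = begin
          2 * a v + length C        ≡⟨ regroup (a v) (length C) ⟩
          a v + (a v + length C)    ≤⟨ +-mono-≤ (a≤ v) (length+∈≤∑ C-centre v∈) ⟩
          a x₀ + suc (∑ C a)        ≡⟨ +-suc (a x₀) _ ⟩
          suc (a x₀ + ∑ C a)        ≤⟨ s≤s stars-total ⟩
          suc (size 𝒜)              ∎
          where
          open ≤-Reasoning
          regroup : ∀ x p → 2 * x + p ≡ x + (x + p)
          regroup = solve-∀

        -- If `C` has a member, then `C-load` applies to it with `1 ≤ a v`. The variable `xs` stands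
        -- for `C` so that it can be matched on.
        C-size : ∀ {xs} → C ≡ xs → length xs ≡ 0 ⊎ suc (length xs) ≤ size 𝒜
        C-size {[]}     _  = inj₁ refl
        C-size {v ∷ xs} eq = inj₂ (s≤s⁻¹ (≤-trans (+-monoˡ-≤ (suc (length xs)) (*-monoʳ-≤ 2 (C-centre v∈)))
                               (subst (λ ys → 2 * a v + length ys ≤ suc (size 𝒜)) eq (C-load v∈))))
          where
          v∈ : v ∈ C
          v∈ = subst (v ∈_) (sym eq) (here refl)

        large : 2 * k ≤ suc (length W)
        large = +-cancelˡ-≤ (length C) _ _ (begin
          length C + 2 * k          ≤⟨ baseRoom m j k≥2 bound 2k≤n (C-size refl) ⟩
          order                         ≡⟨ n≡ ⟨
          suc (length C + length W) ≡⟨ +-suc (length C) _ ⟨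
          length C + suc (length W) ∎)
          where open ≤-Reasoning

        room : ∀ {v} → v ∈ C → ∑ W (𝟙 ∘ F v) + k ≤ suc (length W)
        room {v} v∈ = +-cancelˡ-≤ (length C) _ _ (begin
          length C + (∑ W (𝟙 ∘ F v) + k)   ≤⟨ +-monoʳ-≤ (length C) (+-monoˡ-≤ k out≤) ⟩
          length C + (a v * k + k)         ≡⟨ +-comm (length C) _ ⟩
          a v * k + k + length C           ≤⟨ centreRoom m j (a v) k≥2 bound (∈-length v∈) (C-load v∈) ⟩
          order                                ≡⟨ n≡ ⟨
          suc (length C + length W)        ≡⟨ +-suc (length C) _ ⟨
          length C + suc (length W)        ∎)
          where
          open ≤-Reasoning
          f : Fin order → ℕ
          f = 𝟙 ∘ F v
          out≤ : ∑ W f ≤ a v * k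
          out≤ = begin
            ∑ W f                           ≤⟨ m≤n+m (∑ W f) (∑ C f) ⟩
            ∑ C f + ∑ W f                   ≡⟨ ∑-++ C W f ⟨
            ∑ (C ++ W) f                    ≤⟨ m≤n+m _ (f x₀) ⟩
            ∑ vs f                          ≡⟨ ∑-↭ f vs↭ ⟨
            ∑ (allFin order) f                  ≡⟨ ∑-arcᵇ (disjoint 𝒜) v ⟩
            a v * k                         ∎

        orientation : Orientable k F vs (λ _ → 0)
        orientation = orient k (arcᵇ-irrefl (stars 𝒜)) (arcᵇ-asym (disjoint 𝒜)) W-free large x₀ C unique
          (subst (k ∣_) (sym (trans (sym (∑-↭ (𝟙 ∘ F x₀) vs↭)) (∑-arcᵇ (disjoint 𝒜) x₀))) (n∣m*n (a x₀)))
          room (subst (k ∣_) (trans (C2≡triangle order) (cong triangle (sym length-vs))) k∣nC2)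

        complete : HasCompletion 𝒜
        complete = tournament⇒completion 𝒜 (tournament orientation)
          (λ {v} {w} → extends orientation (in-vs v) (in-vs w))
          (λ v → subst (k ∣_) (sym (∑-↭ (𝟙 ∘ beats (tournament orientation) v) vs↭)) (divisible orientation (in-vs v)))
          where
          in-vs : ∀ v → v ∈ vs
          in-vs v = Perm.∈-resp-↭ vs↭ (∈-allFin v)

    hasCompletion : HasCompletion 𝒜
    hasCompletion = let _ , _ , eq = ∈-∃++ (∈-allFin x₀) in complete eq

-- Evaluating `u`.

open import Data.Integer.Base as ℤ using (+_; _/ℕ_)
import Data.Integer.Properties as ℤ

module _ {k : ℕ} .{{_ : NonZero k}} (k≥2 : 2 ≤ k) (m j : ℕ) where

  private
    order = 2 + (j + m * k)

    exactBranch inexactBranch : ℤ.ℤ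
    exactBranch   = (+ 2 ℤ.* (+ order ℤ.- + 1)) /ℕ k ℤ.- + 2
    inexactBranch = + 2 ℤ.* ((+ order ℤ.- + 2) /ℕ k) ℤ.- + 1

  -- Here n - 1 = (m + 1)k, and the value is 2(m + 1) - 2.
  u-exact : suc j ≡ k → u order k ≡ + (2 * m)
  u-exact 1+j≡k = begin
    u order k                                       ≡⟨ cong (λ b → if b then exactBranch else inexactBranch)
                                                         (dec-true (order % k ℕ.≟ 1 % k) n≡1) ⟩
    (+ 2 ℤ.* + suc (j + m * k)) /ℕ k ℤ.- + 2        ≡⟨ cong (λ i → (+ 2 ℤ.* + i) /ℕ k ℤ.- + 2) multiple ⟩
    (+ 2 ℤ.* + (suc m * k)) /ℕ k ℤ.- + 2            ≡⟨ cong (λ i → i /ℕ k ℤ.- + 2) (ℤ.pos-* 2 (suc m * k)) ⟨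
    + (2 * (suc m * k) / k) ℤ.- + 2                 ≡⟨ cong (λ i → + (i / k) ℤ.- + 2) (*-assoc 2 (suc m) k) ⟨
    + (2 * suc m * k / k) ℤ.- + 2                   ≡⟨ cong (λ i → + i ℤ.- + 2) (m*n/n≡m (2 * suc m) k) ⟩
    + (2 * suc m) ℤ.- + 2                           ≡⟨ cong (λ i → + i ℤ.- + 2) (*-suc 2 m) ⟩
    + (2 * m)                                       ∎
    where
    open ≡-Reasoning
    multiple : suc (j + m * k) ≡ suc m * k
    multiple = cong (_+ m * k) 1+j≡k
    n≡1 : order % k ≡ 1 % k
    n≡1 = trans (cong (λ i → suc i % k) multiple) ([m+kn]%n≡m%n 1 (suc m) k)

  -- Here n - 2 = j + mk has quotient m.
  u-inexact : suc j < k → u order k ≡ + (2 * m) ℤ.- + 1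
  u-inexact 1+j<k = begin
    u order k                                       ≡⟨ cong (λ b → if b then exactBranch else inexactBranch)
                                                         (dec-false (order % k ℕ.≟ 1 % k) n≢1) ⟩
    (+ 2 ℤ.* + ((j + m * k) / k)) ℤ.- + 1           ≡⟨ cong (λ i → + 2 ℤ.* + i ℤ.- + 1) [j+mk]/k≡m ⟩
    + 2 ℤ.* + m ℤ.- + 1                             ≡⟨ cong (ℤ._- + 1) (ℤ.pos-* 2 m) ⟨
    + (2 * m) ℤ.- + 1                               ∎
    where
    open ≡-Reasoning
    [j+mk]/k≡m : (j + m * k) / k ≡ m
    [j+mk]/k≡m = trans (+-distrib-/-∣ʳ j (n∣m*n m)) (cong₂ _+_ (m<n⇒m/n≡0 (<-trans (n<1+n j) 1+j<k)) (m*n/n≡m m k))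
    n≢1 : order % k ≢ 1 % k
    -- The residue of n is j + 2, or 0 if j + 2 = k; that of 1 is 1 because k ≥ 2.
    n≢1 eq with m≤n⇒m<n∨m≡n 1+j<k
    ... | inj₁ 2+j<k = contradiction (trans (sym (trans ([m+kn]%n≡m%n (2 + j) m k) (m<n⇒m%n≡m 2+j<k))) (trans eq (m<n⇒m%n≡m k≥2))) λ ()
    ... | inj₂ refl  = contradiction (trans (sym (trans ([m+kn]%n≡m%n k m k) (n%n≡0 k))) (trans eq (m<n⇒m%n≡m k≥2))) λ ()

u-bound : ∀ {k} .{{_ : NonZero k}} → 2 ≤ k → ∀ m j {a} → j < k →
          + a ℤ.≤ u (2 + (j + m * k)) k → Bound k m j a
u-bound k≥2 m j {a} j<k a≤u with m≤n⇒m<n∨m≡n j<k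
... | inj₂ 1+j≡k = inj₂ (1+j≡k , ℤ.drop‿+≤+ (subst (+ a ℤ.≤_) (u-exact k≥2 m j 1+j≡k) a≤u))
-- The 1 changes sides within ℤ, since the bound is -1 when m = 0.
... | inj₁ 1+j<k = inj₁ (ℤ.drop‿+≤+ (subst (ℤ._≤ + (2 * m)) (cong +_ (+-comm a 1))
  (subst (+ a ℤ.+ + 1 ℤ.≤_) cancel (ℤ.+-monoˡ-≤ (+ 1) (subst (+ a ℤ.≤_) (u-inexact k≥2 m j 1+j<k) a≤u)))))
  where
  cancel : + (2 * m) ℤ.- + 1 ℤ.+ + 1 ≡ + (2 * m)
  cancel = trans (ℤ.+-assoc (+ (2 * m)) (ℤ.- + 1) (+ 1)) (ℤ.+-identityʳ _)

-- Partial designs without completion.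

initialSegment : ∀ i l → Subset (i + l)
initialSegment zero    l = ∅
initialSegment (suc i) l = inside ∷ initialSegment i l

∣initialSegment∣ : ∀ i l → ∣ initialSegment i l ∣ ≡ i
∣initialSegment∣ zero    l = ∣⊥∣≡0 l
∣initialSegment∣ (suc i) l = cong suc (∣initialSegment∣ i l)

-- Stars with different centres can share only the edge joining these centres.
edgeDisjoint′ : ∀ {n k} (S S′ : Star n k) → centre S ≢ centre S′ →
                ¬ (centre S′ ∈ˢ leaves S × centre S ∈ˢ leaves S′) → EdgeDisjoint S S′
edgeDisjoint′ S S′ c≢c′ ¬both = edgeDisjoint S S′
  (λ { (refl , _) (c≡c′ , _) → c≢c′ c≡c′ })
  (λ { (refl , y∈) (refl , x∈) → ¬both (y∈ , x∈) })

-- If a star at `p` through `q` had a leaf `w` outside `Q`, it would share the edge `p w` with a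
-- star avoiding `p q`, and in an edge-disjoint list the two would coincide. So its `k` leaves would
-- all lie in `Q`, which is too small.
blocked : ∀ {n k} (ℬ : PartialDesign n k) {p q : Fin n} (Q : Subset n) → ∣ Q ∣ < k →
          (∀ w → w ≢ p → w ∉ˢ Q → ∃[ S′ ] (S′ ∈ stars ℬ × HasEdge S′ p w × ¬ HasEdge S′ p q)) →
          ∀ {S} → S ∈ stars ℬ → ¬ Arc S p q
blocked ℬ {p} {q} Q ∣Q∣<k used {S} S∈ (p≡c , q∈) =
  <⇒≱ ∣Q∣<k (subst (_≤ ∣ Q ∣) (∣leaves∣ S) (p⊆q⇒∣p∣≤∣q∣ leaves⊆Q))
  where
  leaves⊆Q : leaves S ⊆ˢ Q
  leaves⊆Q {w} w∈ = decidable-stable (w ∈? Q) λ w∉Q →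
    let S′ , S′∈ , edge , ¬edge = used w (λ { refl → Arc-irrefl S (p≡c , w∈) }) w∉Q
    in  ¬edge (subst (λ R → HasEdge R p q) (sameStar (disjoint ℬ) S∈ S′∈ (inj₁ (p≡c , w∈)) edge) (inj₁ (p≡c , q∈)))

-- The vertices 0 and 1 are joined to all of P by m stars each; the stars in
-- extra are meant to meet both of them.  Then 0 and 1 retain fewer than k
-- free edges, and the edge 01 is one of them.
module Obstruction {l k : ℕ} (m : ℕ) (P : Subset l) (∣P∣≡ : ∣ P ∣ ≡ m * k)
  (extra : List (Star (2 + l) k)) (extra-disjoint : AllPairs EdgeDisjoint extra)
  (extra-centre : ∀ {Z} → Z ∈ extra → ∃[ z ] (centre Z ≡ suc (suc z) × z ∉ˢ P))
  (Q : Subset l) (small : suc ∣ Q ∣ < k)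
  (covering : ∀ w → w ∉ˢ Q → w ∈ˢ P ⊎
    Any (λ Z → centre Z ≡ suc (suc w) × zero ∈ˢ leaves Z × suc zero ∈ˢ leaves Z) extra)
  where

  private
    x y : Fin (2 + l)
    x = zero
    y = suc zero

    P⁺ : Subset (2 + l)
    P⁺ = outside ∷ outside ∷ P

    x∉P⁺ : x ∉ˢ P⁺
    x∉P⁺ ()

    y∉P⁺ : y ∉ˢ P⁺
    y∉P⁺ (there ())

    atX = starsAt x m P⁺ x∉P⁺ ∣P∣≡
    atY = starsAt y m P⁺ y∉P⁺ ∣P∣≡
    module X = StarsAt (proj₁ atX)
    module Y = StarsAt (proj₁ atY)

    X-Y : ∀ {S S′} → S ∈ X.list → S′ ∈ Y.list → EdgeDisjoint S S′
    X-Y {S} {S′} S∈ S′∈ with refl , S⊆ ← X.sound S∈ | refl , _ ← Y.sound S′∈ =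
      edgeDisjoint′ S S′ (λ ()) (y∉P⁺ ∘ S⊆ ∘ proj₁)

    extra-XY : ∀ {Z S} → Z ∈ extra → centre S ≡ x ⊎ centre S ≡ y → leaves S ⊆ˢ P⁺ → EdgeDisjoint Z S
    extra-XY {Z} {S} Z∈ c≡ S⊆ with z , refl , z∉P ← extra-centre Z∈ =
      edgeDisjoint′ Z S (λ { refl → [ (λ ()) , (λ ()) ]′ c≡ })
        (λ both → z∉P (drop-there (drop-there (S⊆ (proj₂ both)))))

  obstruction : PartialDesign (2 + l) k
  obstruction = partialDesign (extra ++ X.list ++ Y.list)
    (AllPairs.++⁺ extra-disjoint
      (AllPairs.++⁺ X.apart Y.apart (All.tabulate λ S∈ → All.tabulate (X-Y S∈)))
      (All.tabulate λ Z∈ → All.++⁺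
        (All.tabulate λ {S} S∈ → extra-XY {S = S} Z∈ (inj₁ (proj₁ (X.sound S∈))) (proj₂ (X.sound S∈)))
        (All.tabulate λ {S} S∈ → extra-XY {S = S} Z∈ (inj₂ (proj₁ (Y.sound S∈))) (proj₂ (Y.sound S∈)))))

  size-obstruction : size obstruction ≡ length extra + 2 * m
  size-obstruction = begin
    length (extra ++ X.list ++ Y.list)           ≡⟨ length-++ extra ⟩
    length extra + length (X.list ++ Y.list)     ≡⟨ cong (λ s → length extra + s) (length-++ X.list) ⟩
    length extra + (length X.list + length Y.list) ≡⟨ cong₂ (λ a b → length extra + (a + b)) (proj₂ atX) (proj₂ atY) ⟩
    length extra + (m + m)                       ≡⟨ cong (λ s → length extra + (m + s)) (+-identityʳ m) ⟨
    length extra + 2 * m                         ∎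
    where open ≡-Reasoning

  noCompletion : ¬ HasCompletion obstruction
  noCompletion (ℬ , isDesign , 𝒜⊆ℬ) with find (isDesign x y (λ ()))
  -- The only edges at 0 that may still be free lead to 1 and to `Q`, which makes `suc ∣ Q ∣` of
  -- them. The other case is the same with 0 and 1 exchanged.
  ... | S , S∈ , inj₁ xy = blocked ℬ (outside ∷ inside ∷ Q) small usedX S∈ xy
    where
    usedX : ∀ w → w ≢ x → w ∉ˢ outside ∷ inside ∷ Q → ∃[ S′ ] (S′ ∈ stars ℬ × HasEdge S′ x w × ¬ HasEdge S′ x y)
    usedX zero          w≢x _ = contradiction refl w≢x
    usedX (suc zero)    _ w∉  = contradiction (there here) w∉
    usedX (suc (suc w)) _ w∉ with covering w (λ w∈ → w∉ (there (there w∈)))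
    ... | inj₁ w∈P with S′ , S′∈ , arc ← find (X.covers (there (there w∈P))) =
      S′ , 𝒜⊆ℬ (∈-++⁺ʳ extra (∈-++⁺ˡ S′∈)) , inj₁ arc ,
      λ { (inj₁ (_ , y∈)) → y∉P⁺ (proj₂ (X.sound S′∈) y∈)
        ; (inj₂ (y≡c , _)) → contradiction (trans y≡c (proj₁ (X.sound S′∈))) λ () }
    ... | inj₂ some with Z , Z∈ , c≡ , x∈ , _ ← find some =
      Z , 𝒜⊆ℬ (∈-++⁺ˡ Z∈) , inj₂ (sym c≡ , x∈) ,
      λ { (inj₁ (x≡c , _)) → contradiction (trans x≡c c≡) λ ()
        ; (inj₂ (y≡c , _)) → contradiction (trans y≡c c≡) λ () }
  ... | S , S∈ , inj₂ yx = blocked ℬ (inside ∷ outside ∷ Q) small usedY S∈ yx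
    where
    usedY : ∀ w → w ≢ y → w ∉ˢ inside ∷ outside ∷ Q → ∃[ S′ ] (S′ ∈ stars ℬ × HasEdge S′ y w × ¬ HasEdge S′ y x)
    usedY zero          _ w∉  = contradiction here w∉
    usedY (suc zero)    w≢y _ = contradiction refl w≢y
    usedY (suc (suc w)) _ w∉ with covering w (λ w∈ → w∉ (there (there w∈)))
    ... | inj₁ w∈P with S′ , S′∈ , arc ← find (Y.covers (there (there w∈P))) =
      S′ , 𝒜⊆ℬ (∈-++⁺ʳ extra (∈-++⁺ʳ X.list S′∈)) , inj₁ arc ,
      λ { (inj₁ (_ , x∈)) → x∉P⁺ (proj₂ (Y.sound S′∈) x∈)
        ; (inj₂ (x≡c , _)) → contradiction (trans x≡c (proj₁ (Y.sound S′∈))) λ () }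
    ... | inj₂ some with Z , Z∈ , c≡ , _ , y∈ ← find some =
      Z , 𝒜⊆ℬ (∈-++⁺ˡ Z∈) , inj₂ (sym c≡ , y∈) ,
      λ { (inj₁ (y≡c , _)) → contradiction (trans y≡c c≡) λ ()
        ; (inj₂ (x≡c , _)) → contradiction (trans x≡c c≡) λ () }

∣∁initialSegment∣ : ∀ i l → ∣ ∁ (initialSegment i l) ∣ ≡ l
∣∁initialSegment∣ i l = trans (∣∁p∣≡n∸∣p∣ (initialSegment i l))
  (trans (cong (i + l ∸_) (∣initialSegment∣ i l)) (m+n∸m≡n i l))

notCompletable : ∀ {k} .{{_ : NonZero k}} → 2 ≤ k → ∀ m j → j < k →
  Σ[ 𝒜 ∈ PartialDesign (2 + (j + m * k)) k ]
    (+ size 𝒜 ≡ u (2 + (j + m * k)) k ℤ.+ + 1 × ¬ HasCompletion 𝒜)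
notCompletable {k} k≥2 m j j<k with m≤n⇒m<n∨m≡n j<k
... | inj₁ 1+j<k = obstruction , size≡ , noCompletion
  where
  -- Of the n - 2 vertices besides 0 and 1, the last mk are used as leaves and the first j are not.
  -- With the edge 01 this leaves j + 1 < k free edges at each of 0 and 1.
  L = initialSegment j (m * k)
  noExtra : List (Star (2 + (j + m * k)) k)
  noExtra = []
  noExtra-centre : ∀ {S} → S ∈ noExtra → ∃[ z ] (centre S ≡ suc (suc z) × z ∉ˢ ∁ L)
  noExtra-centre ()
  small : suc ∣ L ∣ < k
  small = subst (λ s → suc s < k) (sym (∣initialSegment∣ j (m * k))) 1+j<k
  covering : ∀ w → w ∉ˢ L → w ∈ˢ ∁ L ⊎
    Any (λ Z → centre Z ≡ suc (suc w) × zero ∈ˢ leaves Z × suc zero ∈ˢ leaves Z) noExtra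
  covering w w∉L = inj₁ (x∉p⇒x∈∁p w∉L)
  open Obstruction {k = k} m (∁ L) (∣∁initialSegment∣ j (m * k))
    noExtra [] noExtra-centre L small covering
  size≡ : + size obstruction ≡ u (2 + (j + m * k)) k ℤ.+ + 1
  size≡ = begin
    + size obstruction               ≡⟨ cong (λ s → + s) size-obstruction ⟩
    + (2 * m)                        ≡⟨ ℤ.+-identityʳ (+ (2 * m)) ⟨
    + (2 * m) ℤ.+ + 0                ≡⟨ ℤ.+-assoc (+ (2 * m)) (ℤ.- + 1) (+ 1) ⟨
    + (2 * m) ℤ.- + 1 ℤ.+ + 1        ≡⟨ cong (λ i → i ℤ.+ + 1) (u-inexact k≥2 m j 1+j<k) ⟨
    u (2 + (j + m * k)) k ℤ.+ + 1    ∎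
    where open ≡-Reasoning
... | inj₂ 1+j≡k = exact j 1+j≡k
  where
  exact : ∀ j → suc j ≡ k → Σ[ 𝒜 ∈ PartialDesign (2 + (j + m * k)) k ]
    (+ size 𝒜 ≡ u (2 + (j + m * k)) k ℤ.+ + 1 × ¬ HasCompletion 𝒜)
  -- This would be k = 1; from here on at least one vertex besides 0 and 1 lies outside `P`.
  exact zero    1≡k   = contradiction 1≡k (<⇒≢ k≥2)
  exact (suc j) 2+j≡k = obstruction , size≡ , noCompletion
    where
    L = initialSegment (suc j) (m * k)
    L₀ = initialSegment j (m * k)
    -- The first vertex outside `P` becomes the centre of the extra star; its k leaves are 0, 1 and
    -- the k - 2 other vertices outside `P`. The free edges at 0 and at 1 thereby drop from k to k -
    -- 1.
    Z : Star (2 + (suc j + m * k)) k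
    Z = star (suc (suc zero)) (inside ∷ inside ∷ outside ∷ L₀) (λ { (there (there ())) })
      (trans (cong (λ s → 2 + s) (∣initialSegment∣ j (m * k))) 2+j≡k)
    covering : ∀ w → w ∉ˢ outside ∷ L₀ → w ∈ˢ ∁ L ⊎
      Any (λ Z → centre Z ≡ suc (suc w) × zero ∈ˢ leaves Z × suc zero ∈ˢ leaves Z) (Z ∷ [])
    covering zero    _   = inj₂ (here (refl , here , there here))
    covering (suc w) w∉  = inj₁ (there (x∉p⇒x∈∁p (w∉ ∘ there)))
    Z-centre : ∀ {S} → S ∈ Z ∷ [] → ∃[ z ] (centre S ≡ suc (suc z) × z ∉ˢ ∁ L)
    Z-centre (here refl) = zero , refl , λ ()
    small : suc ∣ L₀ ∣ < k
    small = subst (λ s → suc s < k) (sym (∣initialSegment∣ j (m * k))) (≤-reflexive 2+j≡k)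
    open Obstruction {k = k} m (∁ L) (∣∁initialSegment∣ (suc j) (m * k))
      (Z ∷ []) ([] ∷ []) Z-centre (outside ∷ L₀) small covering
    size≡ : + size obstruction ≡ u (2 + (suc j + m * k)) k ℤ.+ + 1
    size≡ = begin
      + size obstruction                   ≡⟨ cong (λ s → + s) (trans size-obstruction (+-comm 1 (2 * m))) ⟩
      + (2 * m) ℤ.+ + 1                    ≡⟨ cong (λ i → i ℤ.+ + 1) (u-exact k≥2 m (suc j) 2+j≡k) ⟨
      u (2 + (suc j + m * k)) k ℤ.+ + 1    ∎
      where open ≡-Reasoning

theorem1 : (k : ℕ) .{{_ : NonZero k}} → k ≥ 2 →
    ((n : ℕ) → Admissible k n → n ≥ 2 * k →
    (𝒜 : PartialDesign n k) → + size 𝒜 ℤ.≤ u n k → HasCompletion 𝒜)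
    ×
    ((n : ℕ) → Admissible k n → n > 1 →
    Σ[ 𝒜 ∈ PartialDesign n k ] (+ size 𝒜 ≡ u n k ℤ.+ + 1 × ¬ HasCompletion 𝒜))
theorem1 k k≥2 = completable , uncompletable
  where
  -- Dividing n - 2 instead of n makes m the quotient in the definition of `u`, and n ≡ 1 modulo k
  -- becomes j + 1 = k.
  byRemainder : ∀ {n} (B : ℕ → Set) → 2 ≤ n → (∀ m j → j < k → B (2 + (j + m * k))) → B n
  byRemainder {suc (suc l)} B (s≤s (s≤s _)) b =
    subst (λ i → B (2 + i)) (sym (m≡m%n+[m/n]*n l k)) (b (l / k) (l % k) (m%n<n l k))
  completable : (n : ℕ) → Admissible k n → n ≥ 2 * k →
                (𝒜 : PartialDesign n k) → + size 𝒜 ℤ.≤ u n k → HasCompletion 𝒜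
  completable n (_ , k∣) n≥2k = byRemainder
    (λ n → k ∣ n choose 2 → n ≥ 2 * k → (𝒜 : PartialDesign n k) → + size 𝒜 ℤ.≤ u n k → HasCompletion 𝒜)
    (≤-trans (s≤s (s≤s z≤n)) (≤-trans (*-monoʳ-≤ 2 k≥2) n≥2k))
    (λ m j j<k k∣ 2k≤n 𝒜 a≤u → hasCompletion k≥2 m j k∣ 2k≤n 𝒜 (u-bound k≥2 m j j<k a≤u))
    k∣ n≥2k
  uncompletable : (n : ℕ) → Admissible k n → n > 1 →
                  Σ[ 𝒜 ∈ PartialDesign n k ] (+ size 𝒜 ≡ u n k ℤ.+ + 1 × ¬ HasCompletion 𝒜)
  uncompletable n _ n>1 = byRemainder
    (λ n → Σ[ 𝒜 ∈ PartialDesign n k ] (+ size 𝒜 ≡ u n k ℤ.+ + 1 × ¬ HasCompletion 𝒜)) n>1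
    (notCompletable k≥2)
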